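{- For every integer $n\ge 1$, the $3$-adic valuation of the denominator $\gamma_n$ of $G_n(x)$ is $$\nu_3(\gamma_n)=\begin{cases}\nu_3(\operatorname{lcm}(1,2,\dots,n))-1 & \text{if } n=2\cdot 3^m \text{ for some integer } m\ge 1,\\ \nu_3(\operatorname{lcm}(1,2,\dots,n)) & \text{otherwise.}\end{cases}$$
   Context: For $n\ge1$ define $$G_n(x)=-2i\sum_{k=0}^{\lfloor n/2\rfloor-1}(-1)^k\left[\sum_{j=2k+1}^{n-1}\frac{1}{(n-j)(n-j+1)}\binom{j}{2k+1}\right]x^{n-2k},$$ where $i=\sqrt{ -1}$ and an empty sum is $0$. All coefficients of $G_n$ are rational multiples of $i$. The denominator $\gamma_n$ of $G_n$ is the least positive integer $d$ such that all coefficients of $d\,G_n(x)$ lie in $i\mathbb{Z}$ (so $\gamma_1=1$). $\nu_p(m)$ denotes the exponent of the highest power of the prime $p$ dividing $m$. -}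

module Defs where

open import Data.Nat as ℕ using (ℕ; zero; suc; _∸_; _≤_; z≤n; s≤s; ⌊_/2⌋)
import Data.Nat.Properties as ℕ
open import Data.Nat.Combinatorics using (_C_)
open import Data.Nat.Coprimality using (1-coprimeTo) renaming (sym to coprime-sym)
open import Data.Nat.Divisibility using (_∣_; divides; _∣?_; ∣⇒≤; 1∣_; m∣m*n; n∣m*n; ∣-trans)
open import Data.Nat.LCM using (lcm)
open import Data.Integer as ℤ using (ℤ; +_; -1ℤ)
import Data.Integer.Properties as ℤ
open import Data.Rational using (ℚ; mkℚ; 0ℚ; 1ℚ; _/_; _+_; _*_; _-_; ↥_; ↧ₙ_; toℚᵘ)
import Data.Rational.Properties as ℚ
open import Data.Rational.Unnormalised using (mkℚᵘ; *≡*)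
import Data.Rational.Unnormalised as ℚᵘ
import Data.Rational.Unnormalised.Properties as ℚᵘ
open import Data.List using (List; []; _∷_; _++_; [_]; map; foldr; replicate; applyUpTo; upTo)
open import Data.List.Relation.Unary.All as All using (All; []; _∷_)
import Data.List.Relation.Unary.All.Properties as All
open import Data.Product using (∃; ∃-syntax; _×_; _,_; proj₁; proj₂)
open import Relation.Binary.PropositionalEquality using (_≡_; refl; sym; trans; cong; cong₂; subst)
open import Relation.Nullary using (yes; no)
open import Relation.Nullary.Decidable using (map′; _×-dec_)
open import Relation.Unary using (Decidable)

------------------------------------------------------------------------
-- Gaussian rationals

record ℚ[i] : Set where
  constructor _+i_
  field
    re im : ℚ
open ℚ[i] public

infix  5 _+i_
infixl 6 _⊕_
infixl 7 _⊗_

_⊕_ _⊗_ : ℚ[i] → ℚ[i] → ℚ[i]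
z ⊕ w = (re z + re w) +i (im z + im w)
z ⊗ w = (re z * re w - im z * im w) +i (re z * im w + im z * re w)

fromℚ : ℚ → ℚ[i]
fromℚ q = q +i 0ℚ

fromℤ : ℤ → ℚ[i]
fromℤ a = fromℚ (a / 1)

i : ℚ[i]
i = 0ℚ +i 1ℚ

_∈iℤ : ℚ[i] → Set
z ∈iℤ = ∃[ a ] z ≡ i ⊗ fromℤ a

------------------------------------------------------------------------
-- Polynomials over ℚ[i]: lists of coefficients, constant term first.
-- Trailing zeros are allowed.

Poly : Set
Poly = List ℚ[i]

infixl 6 _⊞_
infixr 7 _·_

_⊞_ : Poly → Poly → Poly
[]      ⊞ Q       = Q
(z ∷ P) ⊞ []      = z ∷ P
(z ∷ P) ⊞ (w ∷ Q) = (z ⊕ w) ∷ (P ⊞ Q)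

_·_ : ℚ[i] → Poly → Poly
c · P = map (c ⊗_) P

monomial : ℚ[i] → ℕ → Poly
monomial c m = replicate m (fromℚ 0ℚ) ++ [ c ]

------------------------------------------------------------------------
-- The polynomials Gₙ

-- The naturals j with a ≤ j < b, in increasing order.
range : ℕ → ℕ → List ℕ
range a b = applyUpTo (λ t → a ℕ.+ t) (b ∸ a)

∑ℚ : List ℕ → (ℕ → ℚ) → ℚ
∑ℚ js f = foldr _+_ 0ℚ (map f js)

∑Poly : List ℕ → (ℕ → Poly) → Poly
∑Poly ks f = foldr _⊞_ [] (map f ks)

-- The value at 0 is junk; below, the argument is (n ∸ j) (n ∸ j + 1) with j < n.
1/ℕ_ : ℕ → ℚ
1/ℕ zero    = 0ℚ
1/ℕ (suc d) = + 1 / suc d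

innerSum : ℕ → ℕ → ℚ
innerSum n k = ∑ℚ (range (2 ℕ.* k ℕ.+ 1) n) λ j →
  (1/ℕ ((n ∸ j) ℕ.* (n ∸ j ℕ.+ 1))) * (+ (j C (2 ℕ.* k ℕ.+ 1)) / 1)

-- Since k < ⌊ n /2⌋, the truncated subtraction in the exponent is exact.
G : ℕ → Poly
G n = (fromℤ (ℤ.- (+ 2)) ⊗ i) · ∑Poly (upTo ⌊ n /2⌋) λ k →
  monomial (fromℚ ((-1ℤ ℤ.^ k) / 1 * innerSum n k)) (n ∸ 2 ℕ.* k)

------------------------------------------------------------------------
-- Denominators

ClearsDenominators : Poly → ℕ → Set
ClearsDenominators P d = 1 ≤ d × All _∈iℤ (fromℤ (+ d) · P)

IsDenominator : Poly → ℕ → Set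
IsDenominator P d =
  ClearsDenominators P d × (∀ e → ClearsDenominators P e → d ≤ e)

-- γ is obtained below as the witness of the existence of a denominator of Gₙ;
-- by γ-isDenominator and antisymmetry of ≤ it is the only one.

least : ∀ {P : ℕ → Set} → Decidable P → ∀ N → P N →
        ∃[ d ] P d × (∀ e → P e → d ≤ e)
least {P} P? N pN = go N 0 pN′ (λ _ _ → z≤n)
  where
  pN′ : P (N ℕ.+ 0)
  pN′ = subst P (sym (ℕ.+-identityʳ N)) pN
  go : ∀ fuel k → P (fuel ℕ.+ k) → (∀ e → P e → k ≤ e) →
       ∃[ d ] P d × (∀ e → P e → d ≤ e)
  go zero       k p lb = k , p , lb
  go (suc fuel) k p lb with P? k
  ... | yes pk = k , pk , lb
  ... | no ¬pk = go fuel (suc k) (subst P (sym (ℕ.+-suc fuel k)) p)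
    λ e pe → ℕ.≤∧≢⇒< (lb e pe) λ { refl → ¬pk pe }

/1-form : ∀ a → a / 1 ≡ mkℚ a 0 (coprime-sym (1-coprimeTo ℤ.∣ a ∣))
/1-form a = ℚ.↥p/↧p≡p (mkℚ a 0 (coprime-sym (1-coprimeTo ℤ.∣ a ∣)))

i⊗ : ∀ a → i ⊗ fromℤ a ≡ 0ℚ +i a / 1
i⊗ a = cong₂ _+i_
  (trans (cong₂ _-_ (ℚ.*-zeroˡ (a / 1)) (ℚ.*-zeroʳ 1ℚ)) refl)
  (trans (cong₂ _+_ (ℚ.*-zeroʳ 0ℚ) (ℚ.*-identityˡ (a / 1))) (ℚ.+-identityˡ (a / 1)))

real⊗ : ∀ q z → fromℚ q ⊗ z ≡ (q * re z) +i (q * im z)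
real⊗ q z = cong₂ _+i_
  (trans (cong (λ t → q * re z - t) (ℚ.*-zeroˡ (im z))) (ℚ.+-identityʳ (q * re z)))
  (trans (cong (λ t → q * im z + t) (ℚ.*-zeroˡ (re z))) (ℚ.+-identityʳ (q * im z)))

_∈iℤ? : Decidable _∈iℤ
(x +i y) ∈iℤ? = map′ to from ((x ℚ.≟ 0ℚ) ×-dec (y ℚ.≟ ↥ y / 1))
  where
  to : x ≡ 0ℚ × y ≡ ↥ y / 1 → (x +i y) ∈iℤ
  to (x≡0 , y≡) = ↥ y , trans (cong₂ _+i_ x≡0 y≡) (sym (i⊗ (↥ y)))
  from : (x +i y) ∈iℤ → x ≡ 0ℚ × y ≡ ↥ y / 1
  from (a , eq) = cong re eq′ , trans y≡ (cong (_/ 1) (sym ↥y≡a))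
    where
    eq′ : (x +i y) ≡ (0ℚ +i a / 1)
    eq′ = trans eq (i⊗ a)
    y≡ : y ≡ a / 1
    y≡ = cong im eq′
    ↥y≡a : ↥ y ≡ a
    ↥y≡a = cong ↥_ (trans y≡ (/1-form a))

clears? : ∀ P → Decidable (ClearsDenominators P)
clears? P d = (1 ℕ.≤? d) ×-dec All.all? _∈iℤ? (fromℤ (+ d) · P)

∣⇒integral : ∀ y {d} → ↧ₙ y ∣ d → ∃[ a ] (+ d / 1) * y ≡ a / 1
∣⇒integral y@(mkℚ n b-1 _) (divides k refl) =
  (+ k) ℤ.* n , ℚ.toℚᵘ-injective (begin
    toℚᵘ ((+ (k ℕ.* suc b-1) / 1) * y)
      ≈⟨ ℚ.toℚᵘ-homo-* (+ (k ℕ.* suc b-1) / 1) y ⟩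
    toℚᵘ (+ (k ℕ.* suc b-1) / 1) ℚᵘ.* mkℚᵘ n b-1
      ≈⟨ ℚᵘ.*-congʳ {mkℚᵘ n b-1} (ℚ.toℚᵘ-fromℚᵘ (mkℚᵘ (+ (k ℕ.* suc b-1)) 0)) ⟩
    mkℚᵘ (+ (k ℕ.* suc b-1)) 0 ℚᵘ.* mkℚᵘ n b-1
      ≈⟨ *≡* cross ⟩
    mkℚᵘ ((+ k) ℤ.* n) 0
      ≈⟨ ℚ.toℚᵘ-fromℚᵘ (mkℚᵘ ((+ k) ℤ.* n) 0) ⟨
    toℚᵘ ((+ k) ℤ.* n / 1) ∎)
  where
  open ℚᵘ.≃-Reasoning
  cross : (+ (k ℕ.* suc b-1) ℤ.* n) ℤ.* + 1 ≡ ((+ k) ℤ.* n) ℤ.* + (1 ℕ.* suc b-1)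
  cross = trans (ℤ.*-identityʳ _)
    (trans (cong (ℤ._* n) (ℤ.pos-* k (suc b-1)))
    (trans (ℤ.*-assoc (+ k) (+ suc b-1) n)
    (trans (cong ((+ k) ℤ.*_) (ℤ.*-comm (+ suc b-1) n))
    (trans (sym (ℤ.*-assoc (+ k) n (+ suc b-1)))
           (cong (λ t → ((+ k) ℤ.* n) ℤ.* + t) (sym (ℕ.*-identityˡ (suc b-1))))))))

Real Imaginary : ℚ[i] → Set
Real z      = im z ≡ 0ℚ
Imaginary z = re z ≡ 0ℚ

⊞-real : ∀ {P Q} → All Real P → All Real Q → All Real (P ⊞ Q)
⊞-real []       qs       = qs
⊞-real (p ∷ ps) []       = p ∷ ps
⊞-real (p ∷ ps) (q ∷ qs) = trans (cong₂ _+_ p q) refl ∷ ⊞-real ps qs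

∑Poly-real : ∀ ks {f} → (∀ k → All Real (f k)) → All Real (∑Poly ks f)
∑Poly-real []       fs = []
∑Poly-real (k ∷ ks) fs = ⊞-real (fs k) (∑Poly-real ks fs)

monomial-real : ∀ q m → All Real (monomial (fromℚ q) m)
monomial-real q zero    = refl ∷ []
monomial-real q (suc m) = refl ∷ monomial-real q m

-2i⊗-imaginary : ∀ {z} → Real z → Imaginary ((fromℤ (ℤ.- (+ 2)) ⊗ i) ⊗ z)
-2i⊗-imaginary {x +i .0ℚ} refl =
  trans (cong (_+ 0ℚ) (ℚ.*-zeroˡ x)) refl

G-imaginary : ∀ n → All Imaginary (G n)
G-imaginary n = All.map⁺ (All.map (λ {z} → -2i⊗-imaginary {z})
  (∑Poly-real (upTo ⌊ n /2⌋) λ k →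
    monomial-real ((-1ℤ ℤ.^ k) / 1 * innerSum n k) (n ∸ 2 ℕ.* k)))

commonMultiple : (P : Poly) → ∃[ d ] 1 ≤ d × All (λ z → ↧ₙ (im z) ∣ d) P
commonMultiple []      = 1 , ℕ.≤-refl , []
commonMultiple (z ∷ P) with commonMultiple P
... | d , 1≤d , ∣d =
  ↧ₙ (im z) ℕ.* d , ℕ.*-mono-≤ {1} {↧ₙ (im z)} {1} {d} (s≤s z≤n) 1≤d ,
  m∣m*n d ∷ All.map (λ h → ∣-trans h (n∣m*n (↧ₙ (im z)))) ∣d

clearable : ∀ {P} → All Imaginary P → ∃[ d ] ClearsDenominators P d
clearable {P} ims with commonMultiple P
... | d , 1≤d , ∣d = d , 1≤d , All.map⁺ (All.map (λ {z} → cleared {z}) (All.zip (ims , ∣d)))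
  where
  cleared : ∀ {z} → Imaginary z × (↧ₙ (im z) ∣ d) → (fromℤ (+ d) ⊗ z) ∈iℤ
  cleared {.0ℚ +i y} (refl , h) with ∣⇒integral y h
  ... | a , eq = a , trans (real⊗ (+ d / 1) (0ℚ +i y))
    (trans (cong₂ _+i_ (ℚ.*-zeroʳ (+ d / 1)) eq) (sym (i⊗ a)))

-- Abstract, to keep the search from being unfolded.
abstract
  denominator : ∀ n → ∃[ d ] IsDenominator (G n) d
  denominator n = let N , cleared = clearable (G-imaginary n)
                  in least (clears? (G n)) N cleared

γ : ℕ → ℕ
γ n = proj₁ (denominator n)

γ-isDenominator : ∀ n → IsDenominator (G n) (γ n)
γ-isDenominator n = proj₂ (denominator n)

------------------------------------------------------------------------
-- Valuations and lcm(1, …, n)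

greatestUpTo : ∀ {P : ℕ → Set} → Decidable P → ℕ → ℕ
greatestUpTo P? zero    = zero
greatestUpTo P? (suc b) with P? (suc b)
... | yes _ = suc b
... | no  _ = greatestUpTo P? b

greatestUpTo-holds : ∀ {P : ℕ → Set} (P? : Decidable P) b → P 0 → P (greatestUpTo P? b)
greatestUpTo-holds P? zero    p0 = p0
greatestUpTo-holds P? (suc b) p0 with P? (suc b)
... | yes p = p
... | no  _ = greatestUpTo-holds P? b p0

greatestUpTo-max : ∀ {P : ℕ → Set} (P? : Decidable P) b k → k ≤ b → P k →
                   k ≤ greatestUpTo P? b
greatestUpTo-max P? zero    k k≤b pk = k≤b
greatestUpTo-max P? (suc b) k k≤b pk with P? (suc b)
... | yes _ = k≤b
... | no ¬p = greatestUpTo-max P? b k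
  (ℕ.≤-pred (ℕ.≤∧≢⇒< k≤b λ { refl → ¬p pk })) pk

k<p^k : ∀ p → 2 ≤ p → ∀ k → k ℕ.< p ℕ.^ k
k<p^k p 2≤p zero    = s≤s z≤n
k<p^k p 2≤p (suc k) = begin-strict
  suc k               <⟨ s≤s ih ⟩
  suc (p ℕ.^ k)       ≤⟨ ℕ.+-monoˡ-≤ (p ℕ.^ k) (ℕ.≤-trans (s≤s z≤n) ih) ⟩
  p ℕ.^ k ℕ.+ p ℕ.^ k ≡⟨ cong (λ t → p ℕ.^ k ℕ.+ t) (ℕ.+-identityʳ (p ℕ.^ k)) ⟨
  2 ℕ.* p ℕ.^ k       ≤⟨ ℕ.*-monoˡ-≤ (p ℕ.^ k) 2≤p ⟩
  p ℕ.* p ℕ.^ k       ∎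
  where
  open ℕ.≤-Reasoning
  ih = k<p^k p 2≤p k

-- For p ≥ 2 and m ≥ 1, pᵏ ∣ m forces k < pᵏ ≤ m, so searching k ≤ m suffices:
-- ν-∣ and ν-max show that ν p m is then the largest k with pᵏ ∣ m.
ν : ℕ → ℕ → ℕ
ν p m = greatestUpTo (λ k → p ℕ.^ k ∣? m) m

ν-∣ : ∀ p m → p ℕ.^ ν p m ∣ m
ν-∣ p m = greatestUpTo-holds (λ k → p ℕ.^ k ∣? m) m (1∣ m)

ν-max : ∀ p m → 2 ≤ p → 1 ≤ m → ∀ k → p ℕ.^ k ∣ m → k ≤ ν p m
ν-max p m@(suc _) 2≤p _ k h = greatestUpTo-max (λ k → p ℕ.^ k ∣? m) m k
  (ℕ.≤-trans (ℕ.<⇒≤ (k<p^k p 2≤p k)) (∣⇒≤ h)) h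

lcm[1…_] : ℕ → ℕ
lcm[1… n ] = foldr lcm 1 (range 1 (suc n))

{-# OPTIONS --safe #-}
module Submission where

open import Defs
open import Data.Nat using (ℕ; zero; suc; pred; _+_; _*_; _∸_; _^_; _≤_; _<_; z≤n; s≤s; z<s; ⌊_/2⌋; NonZero; >-nonZero; ≢-nonZero⁻¹; >-nonZero⁻¹)
open import Data.Nat.Properties
open import Data.Nat.Combinatorics using (_C_; nCn≡1; nC1≡n; nCk≡nC[n∸k]; k>n⇒nCk≡0; nCk+nC[k+1]≡[n+1]C[k+1])
open import Data.Nat.Divisibility
open import Data.Nat.DivMod using (_/_; _%_; m≡m%n+[m/n]*n; m%n<n; m/n*n≡m)
open import Data.Nat.LCM using (lcm; lcm-least; m∣lcm[m,n]; n∣lcm[m,n])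
open import Data.Nat.ListAction using (sum)
open import Data.Nat.Primality using (Prime; prime?; euclidsLemma)
open import Data.Nat.Tactic.RingSolver using (solve-∀)
open import Data.Integer as ℤ using (ℤ; +_; _-_; -1ℤ)
import Data.Integer.Properties as ℤ
import Data.Integer.Tactic.RingSolver as ℤ-Ring
open import Data.Rational as ℚ using (ℚ; 0ℚ; 1ℚ; toℚᵘ; ↥_)
import Data.Rational.Properties as ℚ
import Data.Rational.Solver as ℚ-Solver
open import Data.Rational.Unnormalised as ℚᵘ using (mkℚᵘ; *≡*)
import Data.Rational.Unnormalised.Properties as ℚᵘ
open import Data.List using ([]; _∷_; foldr; map; applyUpTo)
open import Data.List.Properties using (map-applyUpTo)
open import Data.List.Relation.Unary.All as All using (All; []; _∷_)
import Data.List.Relation.Unary.All.Properties as All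
open import Data.Product using (∃-syntax; _×_; _,_; proj₁; proj₂)
open import Data.Sum using (_⊎_; inj₁; inj₂; [_,_]′; map₁)
open import Function using (id; _∘_)
open import Relation.Nullary using (¬_; Dec; yes; no; contradiction)
open import Relation.Nullary.Decidable using (from-yes; from-no)
open import Relation.Binary.PropositionalEquality

-- With H the harmonic numbers and s = 2k, the inner sum equals
-- C(n,s+1) - C(n,s) (Hₙ - Hₛ). Let q = 3^M be the largest power of 3 up to n and
-- N = q K, 3 ∤ K, a common multiple of 1, …, n. Then N clears Gₙ, so ν₃(γₙ) ≤ M, and
-- equality holds once some C(n,s) q (Hₙ - Hₛ) is a 3-adic unit. Modulo 3 only the
-- multiples of q count in q Hₙ.
--   * n = q + a, a < q:       s = 0 works, since q Hₙ ≡ 1.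
--   * n = 2q + a, 0 < a < q:  s = q + 3^t works, with 3^t the leading power of 3 in a.
--   * n = 2q, q > 1:          q Hₙ ≡ 1 + 1/2 ≡ 0, while q Hₛ ≡ 0 for s < q and 3 ∣ C(n,s)
--                             for even s > q, so N/3 clears Gₙ; but (q/3) Hₙ is a unit,
--                             so s = 0 shows that no further factor 3 can be dropped.

-- Binomial coefficients modulo 3

nC0≡1 : ∀ n → n C 0 ≡ 1
nC0≡1 n = trans (nCk≡nC[n∸k] {0} {n} z≤n) (nCn≡1 n)

pascal : ∀ n k → suc n C suc k ≡ n C k + n C suc k
pascal n k = sym (nCk+nC[k+1]≡[n+1]C[k+1] n k)

-- The absorption identity, by induction along Pascal's rule, so that no factorial or division
-- enters.
[1+k]*[1+n]C[1+k]≡[1+n]*nCk : ∀ n k → suc k * (suc n C suc k) ≡ suc n * (n C k)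
[1+k]*[1+n]C[1+k]≡[1+n]*nCk zero zero = refl
[1+k]*[1+n]C[1+k]≡[1+n]*nCk zero (suc k) = begin
  suc (suc k) * (1 C suc (suc k)) ≡⟨ cong (suc (suc k) *_) (k>n⇒nCk≡0 {1} {suc (suc k)} (s≤s (s≤s z≤n))) ⟩
  suc (suc k) * 0                 ≡⟨ *-zeroʳ k ⟩
  1 * 0                           ≡⟨ cong (1 *_) (k>n⇒nCk≡0 {0} {suc k} z<s) ⟨
  1 * (0 C suc k)                 ∎
  where open ≡-Reasoning
[1+k]*[1+n]C[1+k]≡[1+n]*nCk (suc n) zero = begin
  1 * (suc (suc n) C 1)     ≡⟨ *-identityˡ (suc (suc n) C 1) ⟩
  suc (suc n) C 1           ≡⟨ nC1≡n (suc (suc n)) ⟩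
  suc (suc n)               ≡⟨ *-identityʳ (suc (suc n)) ⟨
  suc (suc n) * 1           ≡⟨ cong (suc (suc n) *_) (nC0≡1 (suc n)) ⟨
  suc (suc n) * (suc n C 0) ∎
  where open ≡-Reasoning
[1+k]*[1+n]C[1+k]≡[1+n]*nCk (suc n) (suc k) = begin
  suc (suc k) * (suc (suc n) C suc (suc k))       ≡⟨ cong (suc (suc k) *_) (pascal (suc n) (suc k)) ⟩
  suc (suc k) * (X + Y)                           ≡⟨ expand k X Y ⟩
  X + (suc k * X + suc (suc k) * Y)               ≡⟨ cong (λ z → X + z) (cong₂ _+_ ([1+k]*[1+n]C[1+k]≡[1+n]*nCk n k)
                                                                            ([1+k]*[1+n]C[1+k]≡[1+n]*nCk n (suc k))) ⟩
  X + (suc n * (n C k) + suc n * (n C suc k))     ≡⟨ cong (λ z → X + z) (*-distribˡ-+ (suc n) (n C k) (n C suc k)) ⟨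
  X + suc n * (n C k + n C suc k)                 ≡⟨ cong (λ z → X + suc n * z) (pascal n k) ⟨
  suc (suc n) * X                                 ∎
  where
  open ≡-Reasoning
  X = suc n C suc k
  Y = suc n C suc (suc k)
  expand : ∀ k X Y → suc (suc k) * (X + Y) ≡ X + (suc k * X + suc (suc k) * Y)
  expand = solve-∀

-- The one-sided congruence x ≡ y (mod p), x ≥ y: it avoids subtraction.
infix 4 _≽_[mod_]
record _≽_[mod_] (x y p : ℕ) : Set where
  constructor excess
  field
    t  : ℕ
    eq : x ≡ y + p * t

≽-reflexive : ∀ {p x y} → x ≡ y → x ≽ y [mod p ]
≽-reflexive {p} {x} {y} x≡y = excess 0 (trans x≡y (sym (trans (cong (λ z → y + z) (*-zeroʳ p)) (+-identityʳ y))))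

≽-trans : ∀ {p x y z} → x ≽ y [mod p ] → y ≽ z [mod p ] → x ≽ z [mod p ]
≽-trans {p} {z = z} (excess t refl) (excess u refl) = excess (u + t) (regroup z p t u)
  where
  regroup : ∀ z p t u → z + p * u + p * t ≡ z + p * (u + t)
  regroup = solve-∀

≽-+ : ∀ {p x y x′ y′} → x ≽ y [mod p ] → x′ ≽ y′ [mod p ] → x + x′ ≽ y + y′ [mod p ]
≽-+ {p} {y = y} {y′ = y′} (excess t refl) (excess u refl) = excess (t + u) (regroup y y′ p t u)
  where
  regroup : ∀ y y′ p t u → y + p * t + (y′ + p * u) ≡ y + y′ + p * (t + u)
  regroup = solve-∀

∣⇒≽0 : ∀ {p x} → p ∣ x → x ≽ 0 [mod p ]
∣⇒≽0 {p} (divides t refl) = excess t (*-comm t p)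

≽-∣ : ∀ {p x y} → x ≽ y [mod p ] → p ∣ x → p ∣ y
≽-∣ {p} {y = y} (excess t refl) p∣x = ∣m+n∣m⇒∣n (subst (p ∣_) (+-comm y (p * t)) p∣x) (m∣m*n t)

prime[3] : Prime 3
prime[3] = from-yes (prime? 3)

euclid₃ : ∀ m n → 3 ∣ m * n → 3 ∣ m ⊎ 3 ∣ n
euclid₃ m n = euclidsLemma m n prime[3]

3^≢0 : ∀ m → NonZero (3 ^ m)
3^≢0 m = m^n≢0 3 m

-- Euclid's lemma moves the factors 3 into `y` one at a time.
3^∣*⇒3^∣ : ∀ e {x y} → ¬ 3 ∣ x → 3 ^ e ∣ x * y → 3 ^ e ∣ y
3^∣*⇒3^∣ zero {y = y} _ _ = 1∣ y
3^∣*⇒3^∣ (suc e) {x} {y} 3∤x h with euclid₃ x y (m*n∣⇒m∣ 3 (3 ^ e) h)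
... | inj₁ 3∣x = contradiction 3∣x 3∤x
... | inj₂ (divides z refl) = subst (3 ^ suc e ∣_) (*-comm 3 z)
  (*-monoʳ-∣ 3 (3^∣*⇒3^∣ e 3∤x (*-cancelˡ-∣ 3 (subst (3 ^ suc e ∣_) (regroup x z) h))))
  where
  regroup : ∀ x z → x * (z * 3) ≡ 3 * (x * z)
  regroup = solve-∀

m≤n⇒3^m∣3^n : ∀ {m n} → m ≤ n → 3 ^ m ∣ 3 ^ n
m≤n⇒3^m∣3^n {m} m≤n with m≤n⇒∃[o]m+o≡n m≤n
... | o , refl = subst (3 ^ m ∣_) (sym (^-distribˡ-+-* 3 m o)) (m∣m*n (3 ^ o))

-- Pigeonhole on the factors 3: if `x` holds at most `e - 1` of the `e + d`, then `y` holds at least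
-- `d + 1`. The recursion cancels a 3 from `x` while there is one.
3^∣*-split : ∀ e d x y → 3 ^ (e + d) ∣ x * y → 3 ^ e ∣ x ⊎ 3 ^ suc d ∣ y
3^∣*-split zero d x y _ = inj₁ (1∣ x)
3^∣*-split (suc e) d x y h = case (3 ∣? x)
  where
  Goal = 3 ^ suc e ∣ x ⊎ 3 ^ suc d ∣ y
  regroup : ∀ z y → z * 3 * y ≡ 3 * (z * y)
  regroup = solve-∀
  case : Dec (3 ∣ x) → Goal
  case (no 3∤x) = inj₂ (∣-trans (m≤n⇒3^m∣3^n (s≤s (m≤n+m d e))) (3^∣*⇒3^∣ (suc e + d) 3∤x h))
  case (yes (divides z x≡z*3)) = map₁
    (λ 3^e∣z → subst (3 ^ suc e ∣_) (trans (*-comm 3 z) (sym x≡z*3)) (*-monoʳ-∣ 3 3^e∣z))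
    (3^∣*-split e d z y (*-cancelˡ-∣ 3
      (subst (3 * 3 ^ (e + d) ∣_) (trans (cong (_* y) x≡z*3) (regroup z y)) h)))

-- By absorption `k C(n,k) = n C(n-1,k-1)` is divisible by `3 ^ m`; as `k` cannot absorb all of
-- these factors, one falls to the binomial coefficient.
3^∣n∧3^∤k⇒3∣nCk : ∀ m n k → 3 ^ m ∣ n → ¬ 3 ^ m ∣ k → 3 ∣ n C k
3^∣n∧3^∤k⇒3∣nCk m n       zero    _   q∤k = contradiction ((3 ^ m) ∣0) q∤k
3^∣n∧3^∤k⇒3∣nCk m zero    (suc k) _   _   = subst (3 ∣_) (sym (k>n⇒nCk≡0 {0} {suc k} z<s)) (3 ∣0)
3^∣n∧3^∤k⇒3∣nCk m (suc n) (suc k) q∣n q∤k =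
  [ (λ q∣k → contradiction q∣k q∤k) , id ]′ (3^∣*-split m 0 (suc k) (suc n C suc k)
    (subst₂ _∣_ (cong (3 ^_) (sym (+-identityʳ m))) (sym ([1+k]*[1+n]C[1+k]≡[1+n]*nCk n k))
      (∣m⇒∣m*n (n C k) q∣n)))

-- (1 + x)^q ≡ 1 + x^q (mod 3) for q = 3^m, coefficient by coefficient:
-- multiplying by (1 + x)^a gives the two congruences.
lucas-low : ∀ m a {k} → k < 3 ^ m → (3 ^ m + a) C k ≽ a C k [mod 3 ]
lucas-low m a {zero} _ = ≽-reflexive (trans (nC0≡1 (3 ^ m + a)) (sym (nC0≡1 a)))
lucas-low m zero {suc k} k<q rewrite +-identityʳ (3 ^ m) | k>n⇒nCk≡0 {0} {suc k} z<s =
  ∣⇒≽0 (3^∣n∧3^∤k⇒3∣nCk m (3 ^ m) (suc k) ∣-refl (λ q∣k → <⇒≱ k<q (∣⇒≤ q∣k)))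
lucas-low m (suc a) {suc k} k<q
  rewrite +-suc (3 ^ m) a | pascal (3 ^ m + a) k | pascal a k =
  ≽-+ (lucas-low m a (<-trans (n<1+n k) k<q)) (lucas-low m a k<q)

lucas-high : ∀ m a k → (3 ^ m + a) C (k + 3 ^ m) ≽ a C (k + 3 ^ m) + a C k [mod 3 ]
lucas-high m zero zero
  rewrite +-identityʳ (3 ^ m) | nCn≡1 (3 ^ m) | k>n⇒nCk≡0 {0} {3 ^ m} (m^n>0 3 m) = ≽-reflexive refl
lucas-high m zero (suc k)
  rewrite +-identityʳ (3 ^ m) | k>n⇒nCk≡0 {3 ^ m} {suc k + 3 ^ m} (s≤s (m≤n+m (3 ^ m) k))
        | k>n⇒nCk≡0 {0} {suc k + 3 ^ m} z<s | k>n⇒nCk≡0 {0} {suc k} z<s = ≽-reflexive refl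
-- Pascal's rule leads here to the index `3 ^ m - 1`, which lies below `3 ^ m` and so belongs to
-- `lucas-low`. Matching `3 ^ m` as a successor lets `pascal` apply.
lucas-high m (suc a) zero with 3 ^ m in eq | lucas-low m a {pred (3 ^ m)} | lucas-high m a zero
... | zero  | _ | _ = contradiction eq (≢-nonZero⁻¹ (3 ^ m) {{3^≢0 m}})
... | suc q | low | high rewrite +-suc q a | pascal (suc (q + a)) q | pascal a q | nC0≡1 a | nC0≡1 (suc a) =
  subst ((suc (q + a) C q + suc (q + a) C suc q) ≽_[mod 3 ]) (sym (+-assoc (a C q) (a C suc q) 1))
    (≽-+ (low ≤-refl) high)
lucas-high m (suc a) (suc k)
  rewrite +-suc (3 ^ m) a | pascal (3 ^ m + a) (k + 3 ^ m) | pascal a (k + 3 ^ m) | pascal a k =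
  ≽-trans (≽-+ (lucas-high m a k) (lucas-high m a (suc k)))
    (≽-reflexive (regroup (a C (k + 3 ^ m)) (a C k) (a C suc (k + 3 ^ m)) (a C suc k)))
  where
  regroup : ∀ x y z w → x + y + (z + w) ≡ x + z + (y + w)
  regroup = solve-∀

3∤1 : ¬ 3 ∣ 1
3∤1 = from-no (3 ∣? 1)

3∤2 : ¬ 3 ∣ 2
3∤2 = from-no (3 ∣? 2)

-- The coefficient is congruent modulo 3 to the leading ternary digit of `n`, which is 1 or 2; the
-- two cases compute it with `lucas-high`.
3∤nC3^t : ∀ t n → 3 ^ t ≤ n → n < 3 ^ suc t → ¬ 3 ∣ n C (3 ^ t)
3∤nC3^t t n Q≤n n<3Q 3∣C with m≤n⇒∃[o]m+o≡n Q≤n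
... | a , refl with 3 ^ t ≤? a
... | no Q≰a = 3∤1 (subst (3 ∣_) one (≽-∣ (lucas-high t a 0) 3∣C))
  where
  one : a C (3 ^ t) + a C 0 ≡ 1
  one = cong₂ _+_ (k>n⇒nCk≡0 (≰⇒> Q≰a)) (nC0≡1 a)
... | yes Q≤a with m≤n⇒∃[o]m+o≡n Q≤a
... | b , refl =
  3∤2 (subst (3 ∣_) two (≽-∣ (≽-trans (lucas-high t (3 ^ t + b) 0)
                                      (≽-+ (lucas-high t b 0) (≽-reflexive (nC0≡1 (3 ^ t + b))))) 3∣C))
  where
  b<Q : b < 3 ^ t
  b<Q = +-cancelˡ-< (3 ^ t + 3 ^ t) b (3 ^ t) (subst₂ _<_ (sym (+-assoc (3 ^ t) (3 ^ t) b)) (three (3 ^ t)) n<3Q)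
    where
    three : ∀ x → 3 * x ≡ x + x + x
    three = solve-∀
  two : b C (3 ^ t) + b C 0 + 1 ≡ 2
  two = cong (_+ 1) (cong₂ _+_ (k>n⇒nCk≡0 b<Q) (nC0≡1 b))

-- The harmonic closed form of the inner sum

∑< : ℕ → (ℕ → ℕ) → ℕ
∑< n f = sum (applyUpTo f n)

∑<-cong : ∀ n {f g : ℕ → ℕ} → (∀ j → f j ≡ g j) → ∑< n f ≡ ∑< n g
∑<-cong zero    f≗g = refl
∑<-cong (suc n) f≗g = cong₂ _+_ (f≗g 0) (∑<-cong n (λ j → f≗g (suc j)))

∑<-+ : ∀ n (f g : ℕ → ℕ) → ∑< n (λ j → f j + g j) ≡ ∑< n f + ∑< n g
∑<-+ zero    f g = refl
∑<-+ (suc n) f g = trans (cong (λ z → f 0 + g 0 + z) (∑<-+ n (λ j → f (suc j)) (λ j → g (suc j))))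
  (regroup (f 0) (g 0) (∑< n (λ j → f (suc j))) (∑< n (λ j → g (suc j))))
  where
  regroup : ∀ a b x y → a + b + (x + y) ≡ a + x + (b + y)
  regroup = solve-∀

∑<-drop : ∀ r m (f : ℕ → ℕ) → (∀ {j} → j < r → f j ≡ 0) → ∑< (r + m) f ≡ ∑< m (λ t → f (r + t))
∑<-drop zero    m f f≡0 = refl
∑<-drop (suc r) m f f≡0 = trans (cong (_+ ∑< (r + m) (λ j → f (suc j))) (f≡0 z<s))
  (∑<-drop r m (λ j → f (suc j)) (λ j<r → f≡0 (s≤s j<r)))

-- For `c j = N / j` this is `N` times a harmonic number.
∑₁ : (ℕ → ℕ) → ℕ → ℕ
∑₁ c zero    = 0
∑₁ c (suc n) = ∑₁ c n + c (suc n)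

-- The hypothesis makes `c j` the integer `N / j`, so that identities between fractions can be
-- proved in ℕ after scaling by `N`.
module Partial (c : ℕ → ℕ) (N L : ℕ) (c*j≡N : ∀ j → 1 ≤ j → j ≤ L → c j * j ≡ N) where

  -- The partial fraction `1/m - 1/(m+1) = 1/(m(m+1))`, scaled by `N`; the truncated subtraction is
  -- exact because `c` decreases.
  gap : ℕ → ℕ
  gap m = c m ∸ c (suc m)

  c-antitone : ∀ m → 1 ≤ m → suc m ≤ L → c (suc m) ≤ c m
  c-antitone m@(suc _) 1≤m m<L = *-cancelʳ-≤ (c (suc m)) (c m) m (begin
    c (suc m) * m     ≤⟨ *-monoʳ-≤ (c (suc m)) (n≤1+n m) ⟩
    c (suc m) * suc m ≡⟨ c*j≡N (suc m) (s≤s z≤n) m<L ⟩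
    N                 ≡⟨ c*j≡N m 1≤m (<⇒≤ m<L) ⟨
    c m * m           ∎)
    where open ≤-Reasoning

  gap+ : ∀ m → 1 ≤ m → suc m ≤ L → gap m + c (suc m) ≡ c m
  gap+ m 1≤m m<L = m∸n+n≡m (c-antitone m 1≤m m<L)

  gap*[m*[1+m]]≡N : ∀ m → 1 ≤ m → suc m ≤ L → gap m * (m * suc m) ≡ N
  gap*[m*[1+m]]≡N m 1≤m m<L = +-cancelʳ-≡ (m * N) _ _ (begin
    gap m * (m * suc m) + m * N
      ≡⟨ cong (λ z → gap m * (m * suc m) + m * z) (c*j≡N (suc m) (s≤s z≤n) m<L) ⟨
    gap m * (m * suc m) + m * (c (suc m) * suc m)
      ≡⟨ factor (gap m) m (c (suc m)) ⟩
    (gap m + c (suc m)) * m * suc m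
      ≡⟨ cong (λ z → z * m * suc m) (gap+ m 1≤m m<L) ⟩
    c m * m * suc m
      ≡⟨ cong (_* suc m) (c*j≡N m 1≤m (<⇒≤ m<L)) ⟩
    N * suc m
      ≡⟨ *-comm N (suc m) ⟩
    N + m * N ∎)
    where
    open ≡-Reasoning
    factor : ∀ g m x → g * (m * suc m) + m * (x * suc m) ≡ (g + x) * m * suc m
    factor = solve-∀

  -- For `r = 2k + 1` this is the inner sum scaled by `N`, extended to all `j < n` by vanishing
  -- terms. The term `j = 0` mentions `c (suc n)`, possibly outside the range of `c*j≡N`, but for
  -- `r ≥ 1` its factor `0 C r` is 0.
  gapSum : ℕ → ℕ → ℕ
  gapSum n r = ∑< n (λ j → gap (n ∸ j) * (j C r))

  -- The term `j = 0` vanishes, and shifting `j` by one preserves the distance `n ∸ j`, so Pascal's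
  -- rule applies termwise.
  gapSum-pascal : ∀ n r → gapSum (suc n) (suc r) ≡ gapSum n r + gapSum n (suc r)
  gapSum-pascal n r = begin
    gap (suc n) * (0 C suc r) + ∑< n (λ j → gap (n ∸ j) * (suc j C suc r))
      ≡⟨ cong (λ z → gap (suc n) * z + rest) (k>n⇒nCk≡0 {0} {suc r} z<s) ⟩
    gap (suc n) * 0 + ∑< n (λ j → gap (n ∸ j) * (suc j C suc r))
      ≡⟨ cong (_+ rest) (*-zeroʳ (gap (suc n))) ⟩
    ∑< n (λ j → gap (n ∸ j) * (suc j C suc r))
      ≡⟨ ∑<-cong n (λ j → trans (cong (gap (n ∸ j) *_) (pascal j r)) (*-distribˡ-+ (gap (n ∸ j)) (j C r) (j C suc r))) ⟩
    ∑< n (λ j → gap (n ∸ j) * (j C r) + gap (n ∸ j) * (j C suc r))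
      ≡⟨ ∑<-+ n _ _ ⟩
    gapSum n r + gapSum n (suc r) ∎
    where
    open ≡-Reasoning
    rest = ∑< n (λ j → gap (n ∸ j) * (suc j C suc r))

  -- For `r = 0` the gaps telescope to `c 1 - c (n+1)`, and `c 1 = N`.
  gapSum-telescope : ∀ n → suc n ≤ L → gapSum n 0 + c (suc n) ≡ N
  gapSum-telescope zero 1≤L = trans (sym (*-identityʳ (c 1))) (c*j≡N 1 ≤-refl 1≤L)
  gapSum-telescope (suc n) n<L = begin
    gap (suc n) * (0 C 0) + ∑< n (λ j → gap (n ∸ j) * (suc j C 0)) + c (suc (suc n))
      ≡⟨ cong₂ (λ x y → x + y + c (suc (suc n))) (*-identityʳ (gap (suc n)))
               (∑<-cong n (λ j → cong (gap (n ∸ j) *_) (trans (nC0≡1 (suc j)) (sym (nC0≡1 j))))) ⟩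
    gap (suc n) + gapSum n 0 + c (suc (suc n))
      ≡⟨ regroup (gap (suc n)) (gapSum n 0) (c (suc (suc n))) ⟩
    gapSum n 0 + (gap (suc n) + c (suc (suc n)))
      ≡⟨ cong (λ z → gapSum n 0 + z) (gap+ (suc n) (s≤s z≤n) n<L) ⟩
    gapSum n 0 + c (suc n)
      ≡⟨ gapSum-telescope n (<⇒≤ n<L) ⟩
    N ∎
    where
    open ≡-Reasoning
    regroup : ∀ x y z → x + y + z ≡ y + (x + z)
    regroup = solve-∀

  -- Absorption in the form `C(n+1,r+1)/(n+1) = C(n,r)/(r+1)`, scaled by `N`.
  C-absorb : ∀ n r → suc n ≤ L → suc r ≤ L → (suc n C suc r) * c (suc n) ≡ (n C r) * c (suc r)
  C-absorb n r n<L r<L = *-cancelʳ-≡ _ _ (suc n * suc r) (begin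
    X * c (suc n) * (suc n * suc r)   ≡⟨ regroup₁ X (c (suc n)) (suc n) (suc r) ⟩
    (suc r * X) * (c (suc n) * suc n) ≡⟨ cong₂ _*_ ([1+k]*[1+n]C[1+k]≡[1+n]*nCk n r)
                                           (trans (c*j≡N (suc n) (s≤s z≤n) n<L) (sym (c*j≡N (suc r) (s≤s z≤n) r<L))) ⟩
    (suc n * Y) * (c (suc r) * suc r) ≡⟨ regroup₂ Y (c (suc r)) (suc n) (suc r) ⟩
    Y * c (suc r) * (suc n * suc r)   ∎)
    where
    open ≡-Reasoning
    X = suc n C suc r
    Y = n C r
    regroup₁ : ∀ X z n r → X * z * (n * r) ≡ (r * X) * (z * n)
    regroup₁ = solve-∀
    regroup₂ : ∀ Y z n r → (n * Y) * (z * r) ≡ Y * z * (n * r)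
    regroup₂ = solve-∀

  -- With H the harmonic numbers, this is
  -- ∑ⱼ C(j,r+1) / ((n-j)(n-j+1)) = C(n,r+1) - C(n,r) (Hₙ - Hᵣ), scaled by N.
  gapSum-closed : ∀ n r → n ≤ L → suc r ≤ L →
    gapSum n (suc r) + (n C r) * ∑₁ c n ≡ (n C suc r) * N + (n C r) * ∑₁ c r
  gapSum-closed zero zero _ _ = refl
  gapSum-closed zero (suc r) _ _ =
    trans (*-zeroʳ (0 C suc r))
      (sym (cong₂ (λ x y → x * N + y * ∑₁ c (suc r)) (k>n⇒nCk≡0 {0} {suc (suc r)} z<s) (k>n⇒nCk≡0 {0} {suc r} z<s)))
  gapSum-closed (suc n) zero n<L 0<L = begin
    gapSum (suc n) 1 + (suc n C 0) * (∑₁ c n + c (suc n))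
      ≡⟨ cong₂ (λ x y → x + y * (∑₁ c n + c (suc n))) (gapSum-pascal n 0) (nC0≡1 (suc n)) ⟩
    gapSum n 0 + gapSum n 1 + 1 * (∑₁ c n + c (suc n))
      ≡⟨ regroup (gapSum n 0) (gapSum n 1) (∑₁ c n) (c (suc n)) ⟩
    gapSum n 0 + c (suc n) + (gapSum n 1 + 1 * ∑₁ c n)
      ≡⟨ cong (λ z → gapSum n 0 + c (suc n) + (gapSum n 1 + z * ∑₁ c n)) (nC0≡1 n) ⟨
    gapSum n 0 + c (suc n) + (gapSum n 1 + (n C 0) * ∑₁ c n)
      ≡⟨ cong₂ _+_ (gapSum-telescope n n<L) (gapSum-closed n 0 (<⇒≤ n<L) 0<L) ⟩
    N + ((n C 1) * N + (n C 0) * 0)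
      ≡⟨ cong (λ z → N + ((n C 1) * N + z)) (*-zeroʳ (n C 0)) ⟩
    N + ((n C 1) * N + 0)
      ≡⟨ regroup′ N (n C 1) ⟩
    (1 + n C 1) * N + 1 * 0
      ≡⟨ cong (λ z → (z + n C 1) * N + 1 * 0) (nC0≡1 n) ⟨
    (n C 0 + n C 1) * N + 1 * 0
      ≡⟨ cong₂ (λ x y → x * N + y * 0) (pascal n 0) (nC0≡1 (suc n)) ⟨
    (suc n C 1) * N + (suc n C 0) * 0 ∎
    where
    open ≡-Reasoning
    regroup : ∀ x y p q → x + y + 1 * (p + q) ≡ x + q + (y + 1 * p)
    regroup = solve-∀
    regroup′ : ∀ N x → N + (x * N + 0) ≡ (1 + x) * N + 1 * 0
    regroup′ = solve-∀
  -- Pascal's rule reduces to the hypotheses for `r` and `r + 1`. The leftover term in `c (suc n)`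
  -- becomes, by `C-absorb`, the increment `c (suc r)` that takes the harmonic sum from `r` to
  -- `r + 1`.
  gapSum-closed (suc n) (suc r) n<L r<L = begin
    gapSum (suc n) (suc (suc r)) + (suc n C suc r) * (∑₁ c n + c (suc n))
      ≡⟨ cong (λ z → gapSum (suc n) (suc (suc r)) + z) (*-distribˡ-+ (suc n C suc r) (∑₁ c n) (c (suc n))) ⟩
    gapSum (suc n) (suc (suc r)) + ((suc n C suc r) * ∑₁ c n + (suc n C suc r) * c (suc n))
      ≡⟨ cong₂ _+_ (gapSum-pascal n (suc r))
           (cong₂ _+_ (cong (_* ∑₁ c n) (pascal n r)) (C-absorb n r n<L (<⇒≤ r<L))) ⟩
    gapSum n (suc r) + gapSum n (suc (suc r)) + ((a + b) * ∑₁ c n + a * c (suc r))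
      ≡⟨ regroup (gapSum n (suc r)) (gapSum n (suc (suc r))) a b (∑₁ c n) (c (suc r)) ⟩
    (gapSum n (suc r) + a * ∑₁ c n) + (gapSum n (suc (suc r)) + b * ∑₁ c n) + a * c (suc r)
      ≡⟨ cong (_+ a * c (suc r)) (cong₂ _+_ (gapSum-closed n r (<⇒≤ n<L) (<⇒≤ r<L)) (gapSum-closed n (suc r) (<⇒≤ n<L) r<L)) ⟩
    (b * N + a * ∑₁ c r) + (b′ * N + b * (∑₁ c r + c (suc r))) + a * c (suc r)
      ≡⟨ regroup′ N a b b′ (∑₁ c r) (c (suc r)) ⟩
    (b + b′) * N + (a + b) * (∑₁ c r + c (suc r))
      ≡⟨ cong₂ (λ x y → x * N + y * (∑₁ c r + c (suc r))) (pascal n (suc r)) (pascal n r) ⟨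
    (suc n C suc (suc r)) * N + (suc n C suc r) * (∑₁ c r + c (suc r)) ∎
    where
    open ≡-Reasoning
    a = n C r
    b = n C suc r
    b′ = n C suc (suc r)
    regroup : ∀ x y a b p q → x + y + ((a + b) * p + a * q) ≡ (x + a * p) + (y + b * p) + a * q
    regroup = solve-∀
    regroup′ : ∀ N a b b′ p q → (b * N + a * p) + (b′ * N + b * (p + q)) + a * q ≡ (b + b′) * N + (a + b) * (p + q)
    regroup′ = solve-∀

-- Harmonic sums modulo p

∑₁-block : ∀ {p} c b x → (∀ i → 1 ≤ i → i ≤ b → p ∣ c (i + x)) → ∑₁ c (b + x) ≽ ∑₁ c x [mod p ]
∑₁-block c zero    x p∣c = ≽-reflexive refl
∑₁-block {p} c (suc b) x p∣c = subst (∑₁ c (suc b + x) ≽_[mod p ]) (+-identityʳ (∑₁ c x))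
  (≽-+ (∑₁-block c b x (λ i 1≤i i≤b → p∣c i 1≤i (m≤n⇒m≤1+n i≤b))) (∣⇒≽0 (p∣c (suc b) (s≤s z≤n) ≤-refl)))

∤-between : ∀ {q i} m → 1 ≤ i → i < q → ¬ q ∣ i + m * q
∤-between {q} {suc _} m 1≤i i<q q∣ = <⇒≱ i<q (∣⇒≤ (∣m+n∣m⇒∣n (subst (q ∣_) (+-comm _ (m * q)) q∣) (n∣m*n m)))

-- Every index that is not a multiple of `q` contributes 0 modulo `p`: `tail` discards the last `b`
-- indices, `whole` adds blocks of length `q`.
∑₁-multiples : ∀ {p} c q b m → b < q → (∀ j → 1 ≤ j → j ≤ b + m * q → ¬ q ∣ j → p ∣ c j) →
  ∑₁ c (b + m * q) ≽ ∑₁ (λ i → c (i * q)) m [mod p ]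
∑₁-multiples {p} c q b m b<q p∣c = ≽-trans tail (whole m (λ j 1≤j j≤ → p∣c j 1≤j (≤-trans j≤ (m≤n+m (m * q) b))))
  where
  tail : ∑₁ c (b + m * q) ≽ ∑₁ c (m * q) [mod p ]
  tail = ∑₁-block c b (m * q) (λ i 1≤i i≤b → p∣c (i + m * q) (≤-trans 1≤i (m≤m+n i (m * q)))
    (+-monoˡ-≤ (m * q) i≤b) (∤-between m 1≤i (≤-<-trans i≤b b<q)))
  whole : ∀ m → (∀ j → 1 ≤ j → j ≤ m * q → ¬ q ∣ j → p ∣ c j) → ∑₁ c (m * q) ≽ ∑₁ (λ i → c (i * q)) m [mod p ]
  whole zero    _ = ≽-reflexive refl
  whole (suc m) p∣c with m≤n⇒∃[o]m+o≡n (≤-trans (s≤s z≤n) b<q)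
  -- With `q = suc q′` the last index of the block is `suc m * q`, the one term that is kept.
  ... | q′ , refl = ≽-+
    (≽-trans (∑₁-block c q′ (m * q) (λ i 1≤i i≤q′ → p∣c (i + m * q) (≤-trans 1≤i (m≤m+n i _))
               (≤-trans (+-monoˡ-≤ (m * q) i≤q′) (n≤1+n _)) (∤-between m 1≤i (s≤s i≤q′))))
             (whole m (λ j 1≤j j≤ → p∣c j 1≤j (≤-trans j≤ (m≤n+m (m * q) q)))))
    (≽-reflexive refl)

-- Clearing the denominators of Gₙ

ι : ℤ → ℚ
ι a = a ℚ./ 1

ι-* : ∀ a b → ι (a ℤ.* b) ≡ ι a ℚ.* ι b
ι-* a b = sym (cong₂ ℚ._*_ (/1-form a) (/1-form b))

ι-+ : ∀ a b → ι (a ℤ.+ b) ≡ ι a ℚ.+ ι b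
ι-+ a b = sym (trans (cong₂ ℚ._+_ (/1-form a) (/1-form b))
  (cong₂ (λ x y → ι (x ℤ.+ y)) (ℤ.*-identityʳ a) (ℤ.*-identityʳ b)))

ι-injective : ∀ {a b} → ι a ≡ ι b → a ≡ b
ι-injective {a} {b} eq = cong ↥_ (trans (sym (/1-form a)) (trans eq (/1-form b)))

ι*1/ : ∀ d → ι (+ suc d) ℚ.* (+ 1 ℚ./ suc d) ≡ 1ℚ
ι*1/ d = ℚ.toℚᵘ-injective (begin
  toℚᵘ (ι (+ suc d) ℚ.* (+ 1 ℚ./ suc d))        ≈⟨ ℚ.toℚᵘ-homo-* (ι (+ suc d)) (+ 1 ℚ./ suc d) ⟩
  toℚᵘ (ι (+ suc d)) ℚᵘ.* toℚᵘ (+ 1 ℚ./ suc d)  ≈⟨ ℚᵘ.*-cong (ℚ.toℚᵘ-fromℚᵘ (mkℚᵘ (+ suc d) 0)) (ℚ.toℚᵘ-fromℚᵘ (mkℚᵘ (+ 1) d)) ⟩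
  mkℚᵘ (+ suc d) 0 ℚᵘ.* mkℚᵘ (+ 1) d            ≈⟨ *≡* (trans (trans (ℤ.*-identityʳ _) (ℤ.*-identityʳ (+ suc d)))
                                                         (sym (trans (ℤ.*-identityˡ _) (cong (λ z → + z) (*-identityˡ (suc d)))))) ⟩
  ℚᵘ.1ℚᵘ                                        ∎)
  where open ℚᵘ.≃-Reasoning

ι-cancelˡ : ∀ N {x y} → .{{_ : NonZero N}} → ι (+ N) ℚ.* x ≡ ι (+ N) ℚ.* y → x ≡ y
ι-cancelˡ (suc N) {x} {y} eq = begin
  x                                            ≡⟨ unscale x ⟨
  (+ 1 ℚ./ suc N) ℚ.* (ι (+ suc N) ℚ.* x)      ≡⟨ cong ((+ 1 ℚ./ suc N) ℚ.*_) eq ⟩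
  (+ 1 ℚ./ suc N) ℚ.* (ι (+ suc N) ℚ.* y)      ≡⟨ unscale y ⟩
  y                                            ∎
  where
  open ≡-Reasoning
  unscale : ∀ z → (+ 1 ℚ./ suc N) ℚ.* (ι (+ suc N) ℚ.* z) ≡ z
  unscale z = trans (sym (ℚ.*-assoc (+ 1 ℚ./ suc N) (ι (+ suc N)) z))
    (trans (cong (ℚ._* z) (trans (ℚ.*-comm (+ 1 ℚ./ suc N) (ι (+ suc N))) (ι*1/ N))) (ℚ.*-identityˡ z))

∑ℚ-scaled : ∀ a js {f : ℕ → ℚ} {g : ℕ → ℕ} → All (λ j → a ℚ.* f j ≡ ι (+ g j)) js →
  a ℚ.* ∑ℚ js f ≡ ι (+ sum (map g js))
∑ℚ-scaled a []       []         = ℚ.*-zeroʳ a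
∑ℚ-scaled a (j ∷ js) {f} {g} (eq ∷ eqs) = begin
  a ℚ.* (f j ℚ.+ ∑ℚ js f)               ≡⟨ ℚ.*-distribˡ-+ a (f j) (∑ℚ js f) ⟩
  a ℚ.* f j ℚ.+ a ℚ.* ∑ℚ js f           ≡⟨ cong₂ ℚ._+_ eq (∑ℚ-scaled a js eqs) ⟩
  ι (+ g j) ℚ.+ ι (+ sum (map g js))   ≡⟨ ι-+ (+ g j) (+ sum (map g js)) ⟨
  ι (+ g j ℤ.+ + sum (map g js))       ∎
  where open ≡-Reasoning

ι*1/ℕ : ∀ N e d → .{{_ : NonZero d}} → e * d ≡ N → ι (+ N) ℚ.* (1/ℕ d) ≡ ι (+ e)
ι*1/ℕ N e (suc d) refl = begin
  ι (+ (e * suc d)) ℚ.* (+ 1 ℚ./ suc d)           ≡⟨ cong (λ z → ι z ℚ.* (+ 1 ℚ./ suc d)) (ℤ.pos-* e (suc d)) ⟩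
  ι (+ e ℤ.* + suc d) ℚ.* (+ 1 ℚ./ suc d)         ≡⟨ cong (ℚ._* (+ 1 ℚ./ suc d)) (ι-* (+ e) (+ suc d)) ⟩
  ι (+ e) ℚ.* ι (+ suc d) ℚ.* (+ 1 ℚ./ suc d)     ≡⟨ ℚ.*-assoc (ι (+ e)) (ι (+ suc d)) (+ 1 ℚ./ suc d) ⟩
  ι (+ e) ℚ.* (ι (+ suc d) ℚ.* (+ 1 ℚ./ suc d))   ≡⟨ cong (ι (+ e) ℚ.*_) (ι*1/ d) ⟩
  ι (+ e) ℚ.* 1ℚ                                  ≡⟨ ℚ.*-identityʳ (ι (+ e)) ⟩
  ι (+ e)                                         ∎
  where open ≡-Reasoning

module _ (c : ℕ → ℕ) (N n : ℕ) (c*j≡N : ∀ j → 1 ≤ j → j ≤ n → c j * j ≡ N) where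
  open Partial c N n c*j≡N

  -- `C(j,r) = 0` for `j < r`, so the sum from `r` equals the sum from 0 that defines `gapSum`.
  innerSum-scaled : ∀ k → suc (2 * k) ≤ n → ι (+ N) ℚ.* innerSum n k ≡ ι (+ gapSum n (suc (2 * k)))
  innerSum-scaled k r≤n rewrite +-comm (2 * k) 1 = begin
    ι (+ N) ℚ.* ∑ℚ (range r n) f                      ≡⟨ ∑ℚ-scaled (ι (+ N)) (range r n) (All.applyUpTo⁺₁ (λ t → r + t) (n ∸ r) term) ⟩
    ι (+ sum (map g (range r n)))                    ≡⟨ cong (λ z → ι (+ sum z)) (map-applyUpTo (λ t → r + t) g (n ∸ r)) ⟩
    ι (+ ∑< (n ∸ r) (λ t → g (r + t)))                ≡⟨ cong (λ z → ι (+ z)) (∑<-drop r (n ∸ r) g g≡0) ⟨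
    ι (+ ∑< (r + (n ∸ r)) g)                          ≡⟨ cong (λ z → ι (+ ∑< z g)) (m+[n∸m]≡n r≤n) ⟩
    ι (+ gapSum n r)                                  ∎
    where
    open ≡-Reasoning
    r = suc (2 * k)
    f : ℕ → ℚ
    f j = (1/ℕ ((n ∸ j) * (n ∸ j + 1))) ℚ.* ι (+ (j C r))
    g : ℕ → ℕ
    g j = gap (n ∸ j) * (j C r)
    g≡0 : ∀ {j} → j < r → g j ≡ 0
    g≡0 {j} j<r = trans (cong (gap (n ∸ j) *_) (k>n⇒nCk≡0 j<r)) (*-zeroʳ (gap (n ∸ j)))
    term : ∀ {t} → t < n ∸ r → ι (+ N) ℚ.* f (r + t) ≡ ι (+ g (r + t))
    term {t} t<n∸r = begin
      ι (+ N) ℚ.* ((1/ℕ (m * (m + 1))) ℚ.* ι (+ (j C r)))  ≡⟨ ℚ.*-assoc (ι (+ N)) (1/ℕ (m * (m + 1))) (ι (+ (j C r))) ⟨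
      ι (+ N) ℚ.* (1/ℕ (m * (m + 1))) ℚ.* ι (+ (j C r))    ≡⟨ cong (λ z → ι (+ N) ℚ.* (1/ℕ (m * z)) ℚ.* ι (+ (j C r))) (+-comm m 1) ⟩
      ι (+ N) ℚ.* (1/ℕ (m * suc m)) ℚ.* ι (+ (j C r))      ≡⟨ cong (ℚ._* ι (+ (j C r))) (ι*1/ℕ N (gap m) (m * suc m) (gap*[m*[1+m]]≡N m 1≤m m<n)) ⟩
      ι (+ gap m) ℚ.* ι (+ (j C r))                        ≡⟨ ι-* (+ gap m) (+ (j C r)) ⟨
      ι (+ gap m ℤ.* + (j C r))                            ≡⟨ cong ι (ℤ.pos-* (gap m) (j C r)) ⟨
      ι (+ g j)                                            ∎
      where
      j = r + t
      m = n ∸ j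
      1≤m : 1 ≤ m
      1≤m = m<n⇒0<n∸m (subst (j <_) (m+[n∸m]≡n r≤n) (+-monoʳ-< r t<n∸r))
      -- Strict because `j ≥ r ≥ 1`; this keeps `suc m` within the range of `c*j≡N`.
      m<n : m < n
      m<n = ∸-monoʳ-< {n} {j} {0} z<s (<⇒≤ (subst (j <_) (m+[n∸m]≡n r≤n) (+-monoʳ-< r t<n∸r)))
      instance
        m*[1+m]≢0 : NonZero (m * suc m)
        m*[1+m]≢0 = m*n≢0 m (suc m) {{>-nonZero 1≤m}}

-- Coefficients of polynomials

⊕-identityˡ : ∀ z → fromℚ 0ℚ ⊕ z ≡ z
⊕-identityˡ z = cong₂ _+i_ (ℚ.+-identityˡ (re z)) (ℚ.+-identityˡ (im z))

⊕-identityʳ : ∀ z → z ⊕ fromℚ 0ℚ ≡ z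
⊕-identityʳ z = cong₂ _+i_ (ℚ.+-identityʳ (re z)) (ℚ.+-identityʳ (im z))

-- Reading past the end gives 0, so that coefficients add under `⊞` whatever the lengths of the
-- lists.
coef : Poly → ℕ → ℚ[i]
coef []      m       = fromℚ 0ℚ
coef (z ∷ P) zero    = z
coef (z ∷ P) (suc m) = coef P m

coef-All : ∀ {S : ℚ[i] → Set} {P} m → S (fromℚ 0ℚ) → All S P → S (coef P m)
coef-All m       S0 []       = S0
coef-All zero    S0 (s ∷ ss) = s
coef-All (suc m) S0 (s ∷ ss) = coef-All m S0 ss

coef-⊞ : ∀ P Q m → coef (P ⊞ Q) m ≡ coef P m ⊕ coef Q m
coef-⊞ []      Q       m       = sym (⊕-identityˡ (coef Q m))
coef-⊞ (z ∷ P) []      m       = sym (⊕-identityʳ (coef (z ∷ P) m))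
coef-⊞ (z ∷ P) (w ∷ Q) zero    = refl
coef-⊞ (z ∷ P) (w ∷ Q) (suc m) = coef-⊞ P Q m

coef-monomial : ∀ z m → coef (monomial z m) m ≡ z
coef-monomial z zero    = refl
coef-monomial z (suc m) = coef-monomial z m

coef-monomial-≢ : ∀ z m m′ → m ≢ m′ → coef (monomial z m) m′ ≡ fromℚ 0ℚ
coef-monomial-≢ z zero    zero     m≢m′ = contradiction refl m≢m′
coef-monomial-≢ z zero    (suc m′) m≢m′ = refl
coef-monomial-≢ z (suc m) zero     m≢m′ = refl
coef-monomial-≢ z (suc m) (suc m′) m≢m′ = coef-monomial-≢ z m m′ (m≢m′ ∘ cong suc)

coef-∑-zero : ∀ (g : ℕ → ℕ) h f m → (∀ {k} → k < h → coef (f (g k)) m ≡ fromℚ 0ℚ) →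
  coef (∑Poly (applyUpTo g h) f) m ≡ fromℚ 0ℚ
coef-∑-zero g zero    f m f≡0 = refl
coef-∑-zero g (suc h) f m f≡0 = trans (coef-⊞ (f (g 0)) (∑Poly (applyUpTo (g ∘ suc) h) f) m)
  (trans (cong₂ _⊕_ (f≡0 z<s) (coef-∑-zero (g ∘ suc) h f m (f≡0 ∘ s≤s))) (⊕-identityˡ (fromℚ 0ℚ)))

coef-∑-single : ∀ (g : ℕ → ℕ) h f m {k} → k < h →
  (∀ {k′} → k′ < h → k′ ≢ k → coef (f (g k′)) m ≡ fromℚ 0ℚ) →
  coef (∑Poly (applyUpTo g h) f) m ≡ coef (f (g k)) m
coef-∑-single g (suc h) f m {zero} k<h f≡0 = trans (coef-⊞ (f (g 0)) (∑Poly (applyUpTo (g ∘ suc) h) f) m)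
  (trans (cong (coef (f (g 0)) m ⊕_) (coef-∑-zero (g ∘ suc) h f m (λ k<h → f≡0 (s≤s k<h) λ ())))
    (⊕-identityʳ (coef (f (g 0)) m)))
coef-∑-single g (suc h) f m {suc k} (s≤s k<h) f≡0 = trans (coef-⊞ (f (g 0)) (∑Poly (applyUpTo (g ∘ suc) h) f) m)
  (trans (cong₂ _⊕_ (f≡0 z<s λ ())
                    (coef-∑-single (g ∘ suc) h f m k<h (λ k′<h k′≢k → f≡0 (s≤s k′<h) (k′≢k ∘ suc-injective))))
    (⊕-identityˡ (coef (f (g (suc k))) m)))

2+2k≤n : ∀ {n k} → k < ⌊ n /2⌋ → suc (suc (2 * k)) ≤ n
2+2k≤n {n} {k} k<h = subst (_≤ n) (2*[1+k] k) (≤-trans (*-monoʳ-≤ 2 k<h) (2⌊n/2⌋≤n n))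
  where
  2*[1+k] : ∀ k → 2 * suc k ≡ suc (suc (2 * k))
  2*[1+k] = solve-∀
  2⌊n/2⌋≤n : ∀ n → 2 * ⌊ n /2⌋ ≤ n
  2⌊n/2⌋≤n n = subst₂ _≤_ (cong (λ z → ⌊ n /2⌋ + z) (sym (+-identityʳ ⌊ n /2⌋))) (⌊n/2⌋+⌈n/2⌉≡n n)
    (+-monoʳ-≤ ⌊ n /2⌋ (⌊n/2⌋≤⌈n/2⌉ n))

-- Times `-2i`, this is the coefficient of the power `n - 2k` in `G n`.
signedSum : ℕ → ℕ → ℚ
signedSum n k = ι (-1ℤ ℤ.^ k) ℚ.* innerSum n k

Integral : ℚ → Set
Integral x = ∃[ a ] x ≡ ι a

cleared : ℕ → ℚ → ℚ
cleared d x = ι (+ d) ℚ.* (ι (ℤ.- + 2) ℚ.* x)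

scale-real : ∀ d x → fromℤ (+ d) ⊗ ((fromℤ (ℤ.- + 2) ⊗ i) ⊗ fromℚ x) ≡ 0ℚ +i cleared d x
scale-real d x = trans (real⊗ (ι (+ d)) ((fromℤ (ℤ.- + 2) ⊗ i) ⊗ fromℚ x))
  (cong₂ _+i_
    (trans (cong (λ z → ι (+ d) ℚ.* (z ℚ.- ι (ℤ.- + 2) ℚ.* 0ℚ)) (ℚ.*-zeroˡ x)) (ℚ.*-zeroʳ (ι (+ d))))
    (cong (ι (+ d) ℚ.*_) (ℚ.+-identityˡ (ι (ℤ.- + 2) ℚ.* x))))

module _ (n d : ℕ) where

  Clears : ℚ[i] → Set
  Clears z = (fromℤ (+ d) ⊗ ((fromℤ (ℤ.- + 2) ⊗ i) ⊗ z)) ∈iℤ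

  Clears⇒Integral : ∀ {x} → Clears (fromℚ x) → Integral (cleared d x)
  Clears⇒Integral {x} (a , eq) = a , cong im (trans (sym (scale-real d x)) (trans eq (i⊗ a)))

  Integral⇒Clears : ∀ {z} → Real z × Integral (cleared d (re z)) → Clears z
  Integral⇒Clears {x +i .0ℚ} (refl , a , eq) = a , trans (scale-real d x) (trans (cong (0ℚ +i_) eq) (sym (i⊗ a)))

  RealIntegral : ℚ[i] → Set
  RealIntegral z = Real z × Integral (cleared d (re z))

  integral-0 : Integral (cleared d 0ℚ)
  integral-0 = + 0 , ℚ.*-zeroʳ (ι (+ d))

  integral-+ : ∀ {x y} → Integral (cleared d x) → Integral (cleared d y) → Integral (cleared d (x ℚ.+ y))
  integral-+ {x} {y} (a , eqa) (b , eqb) = a ℤ.+ b ,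
    trans (cong (ι (+ d) ℚ.*_) (ℚ.*-distribˡ-+ (ι (ℤ.- + 2)) x y))
    (trans (ℚ.*-distribˡ-+ (ι (+ d)) (ι (ℤ.- + 2) ℚ.* x) (ι (ℤ.- + 2) ℚ.* y))
    (trans (cong₂ ℚ._+_ eqa eqb) (sym (ι-+ a b))))

  ⊞-realIntegral : ∀ {P Q} → All RealIntegral P → All RealIntegral Q → All RealIntegral (P ⊞ Q)
  ⊞-realIntegral []       qs = qs
  ⊞-realIntegral (p ∷ ps) [] = p ∷ ps
  ⊞-realIntegral {z ∷ _} {w ∷ _} ((p , p′) ∷ ps) ((q , q′) ∷ qs) = (cong₂ ℚ._+_ p q , integral-+ {re z} {re w} p′ q′) ∷ ⊞-realIntegral ps qs

  ∑Poly-realIntegral : ∀ {ks f} → All (λ k → All RealIntegral (f k)) ks → All RealIntegral (∑Poly ks f)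
  ∑Poly-realIntegral []       = []
  ∑Poly-realIntegral (p ∷ ps) = ⊞-realIntegral p (∑Poly-realIntegral ps)

  monomial-realIntegral : ∀ {x} m → Integral (cleared d x) → All RealIntegral (monomial (fromℚ x) m)
  monomial-realIntegral zero    h = (refl , h) ∷ []
  monomial-realIntegral (suc m) h = (refl , integral-0) ∷ monomial-realIntegral m h

  integral⇒clears : 1 ≤ d → (∀ k → k < ⌊ n /2⌋ → Integral (cleared d (signedSum n k))) → ClearsDenominators (G n) d
  integral⇒clears 1≤d h = 1≤d , All.map⁺ (All.map⁺ (All.map (λ {z} → Integral⇒Clears {z}) (∑Poly-realIntegral
    (All.applyUpTo⁺₁ id ⌊ n /2⌋ (λ {k} k<h → monomial-realIntegral (n ∸ 2 * k) (h k k<h))))))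

  -- The exponents `n ∸ 2 * k` are distinct for `k < ⌊ n /2⌋`, so no two monomials mix and each
  -- coefficient can be read off.
  clears⇒integral : ClearsDenominators (G n) d → ∀ k → k < ⌊ n /2⌋ → Integral (cleared d (signedSum n k))
  clears⇒integral (_ , all) k k<h = Clears⇒Integral {signedSum n k} (subst Clears
    (trans (coef-∑-single id ⌊ n /2⌋ f m k<h
             (λ {k′} k′<h k′≢k → coef-monomial-≢ _ (n ∸ 2 * k′) m
               (λ eq → k′≢k (*-cancelˡ-≡ k′ k 2 (∸-cancelˡ-≡ (2k≤n k′<h) (2k≤n k<h) eq)))))
           (coef-monomial (fromℚ (signedSum n k)) m))
    (coef-All {Clears} m (+ 0 , refl′) (All.map⁻ (All.map⁻ all))))
    where
    f : ℕ → Poly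
    f k = monomial (fromℚ (signedSum n k)) (n ∸ 2 * k)
    m = n ∸ 2 * k
    refl′ = trans (scale-real d 0ℚ) (trans (cong (0ℚ +i_) (proj₂ integral-0)) (sym (i⊗ (+ 0))))
    2k≤n : ∀ {k} → k < ⌊ n /2⌋ → 2 * k ≤ n
    2k≤n k<h = ≤-trans (n≤1+n _) (<⇒≤ (2+2k≤n k<h))

∣-1^k∣≡1 : ∀ k → ℤ.∣ -1ℤ ℤ.^ k ∣ ≡ 1
∣-1^k∣≡1 zero    = refl
∣-1^k∣≡1 (suc k) = trans (ℤ.abs-* -1ℤ (-1ℤ ℤ.^ k)) (cong (1 *_) (∣-1^k∣≡1 k))

module _ {N x A} (N*x≡A : ι (+ N) ℚ.* x ≡ ι (+ A)) (d k : ℕ) where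

  private
    σ = -1ℤ ℤ.^ k

  cleared-scaled : ι (+ N) ℚ.* cleared d (ι σ ℚ.* x) ≡ ι (+ d ℤ.* (ℤ.- + 2 ℤ.* (σ ℤ.* + A)))
  cleared-scaled = begin
    ι (+ N) ℚ.* (ι (+ d) ℚ.* (ι (ℤ.- + 2) ℚ.* (ι σ ℚ.* x)))   ≡⟨ inwards (ι (+ N)) (ι (+ d)) (ι (ℤ.- + 2)) (ι σ) x ⟩
    ι (+ d) ℚ.* (ι (ℤ.- + 2) ℚ.* (ι σ ℚ.* (ι (+ N) ℚ.* x)))   ≡⟨ cong (λ z → ι (+ d) ℚ.* (ι (ℤ.- + 2) ℚ.* (ι σ ℚ.* z))) N*x≡A ⟩
    ι (+ d) ℚ.* (ι (ℤ.- + 2) ℚ.* (ι σ ℚ.* ι (+ A)))           ≡⟨ cong (λ z → ι (+ d) ℚ.* (ι (ℤ.- + 2) ℚ.* z)) (ι-* σ (+ A)) ⟨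
    ι (+ d) ℚ.* (ι (ℤ.- + 2) ℚ.* ι (σ ℤ.* + A))               ≡⟨ cong (ι (+ d) ℚ.*_) (ι-* (ℤ.- + 2) (σ ℤ.* + A)) ⟨
    ι (+ d) ℚ.* ι (ℤ.- + 2 ℤ.* (σ ℤ.* + A))                   ≡⟨ ι-* (+ d) (ℤ.- + 2 ℤ.* (σ ℤ.* + A)) ⟨
    ι (+ d ℤ.* (ℤ.- + 2 ℤ.* (σ ℤ.* + A)))                     ∎
    where
    open ≡-Reasoning
    inwards : ∀ n d t s x → n ℚ.* (d ℚ.* (t ℚ.* (s ℚ.* x))) ≡ d ℚ.* (t ℚ.* (s ℚ.* (n ℚ.* x)))
    inwards = solve 5 (λ n d t s x → n :* (d :* (t :* (s :* x))) := d :* (t :* (s :* (n :* x)))) refl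
      where open ℚ-Solver.+-*-Solver

  -- Taking absolute values removes the signs of `-2` and of `σ`.
  integral⇒∣ : Integral (cleared d (ι σ ℚ.* x)) → N ∣ d * (2 * A)
  integral⇒∣ (a , eq) = divides ℤ.∣ a ∣ (begin
    d * (2 * A)                                   ≡⟨ cong (λ z → d * (2 * z)) (*-identityˡ A) ⟨
    d * (2 * (1 * A))                             ≡⟨ cong (λ z → d * (2 * (z * A))) (∣-1^k∣≡1 k) ⟨
    d * (2 * (ℤ.∣ σ ∣ * A))                         ≡⟨ cong (λ z → d * (2 * z)) (ℤ.abs-* σ (+ A)) ⟨
    d * (2 * ℤ.∣ σ ℤ.* + A ∣)                       ≡⟨ cong (d *_) (ℤ.abs-* (ℤ.- + 2) (σ ℤ.* + A)) ⟨
    d * ℤ.∣ ℤ.- + 2 ℤ.* (σ ℤ.* + A) ∣               ≡⟨ ℤ.abs-* (+ d) (ℤ.- + 2 ℤ.* (σ ℤ.* + A)) ⟨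
    ℤ.∣ + d ℤ.* (ℤ.- + 2 ℤ.* (σ ℤ.* + A)) ∣         ≡⟨ cong ℤ.∣_∣ (ι-injective {+ d ℤ.* (ℤ.- + 2 ℤ.* (σ ℤ.* + A))} {+ N ℤ.* a} (trans (sym cleared-scaled)
                                                       (trans (cong (ι (+ N) ℚ.*_) eq) (sym (ι-* (+ N) a))))) ⟩
    ℤ.∣ + N ℤ.* a ∣                                 ≡⟨ ℤ.abs-* (+ N) a ⟩
    N * ℤ.∣ a ∣                                     ≡⟨ *-comm N ℤ.∣ a ∣ ⟩
    ℤ.∣ a ∣ * N                                     ∎)
    where open ≡-Reasoning

  ∣⇒integral-cleared : .{{_ : NonZero N}} → N ∣ d * (2 * A) → Integral (cleared d (ι σ ℚ.* x))
  ∣⇒integral-cleared (divides b eq) = a , ι-cancelˡ N (begin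
    ι (+ N) ℚ.* cleared d (ι σ ℚ.* x)             ≡⟨ cleared-scaled ⟩
    ι (+ d ℤ.* (ℤ.- + 2 ℤ.* (σ ℤ.* + A)))         ≡⟨ cong ι (regroup (+ d) (+ 2) σ (+ A)) ⟩
    ι ((ℤ.- σ) ℤ.* (+ d ℤ.* (+ 2 ℤ.* + A)))       ≡⟨ cong (λ z → ι ((ℤ.- σ) ℤ.* z)) eqℤ ⟩
    ι ((ℤ.- σ) ℤ.* (+ b ℤ.* + N))                 ≡⟨ cong ι (regroup′ σ (+ b) (+ N)) ⟩
    ι (+ N ℤ.* a)                                 ≡⟨ ι-* (+ N) a ⟩
    ι (+ N) ℚ.* ι a                               ∎)
    where
    open ≡-Reasoning
    -- `-σ` is the sign of `-2 σ`, restored to the natural quotient `b`.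
    a = (ℤ.- σ) ℤ.* + b
    eqℤ : + d ℤ.* (+ 2 ℤ.* + A) ≡ + b ℤ.* + N
    eqℤ = trans (cong (+ d ℤ.*_) (sym (ℤ.pos-* 2 A)))
      (trans (sym (ℤ.pos-* d (2 * A))) (trans (cong (λ z → + z) eq) (ℤ.pos-* b N)))
    regroup : ∀ d t s A → d ℤ.* ((ℤ.- t) ℤ.* (s ℤ.* A)) ≡ (ℤ.- s) ℤ.* (d ℤ.* (t ℤ.* A))
    regroup = ℤ-Ring.solve-∀
    regroup′ : ∀ s b n → (ℤ.- s) ℤ.* (b ℤ.* n) ≡ n ℤ.* ((ℤ.- s) ℤ.* b)
    regroup′ = ℤ-Ring.solve-∀

module Clearing (c : ℕ → ℕ) (N n : ℕ) .{{_ : NonZero N}} (c*j≡N : ∀ j → 1 ≤ j → j ≤ n → c j * j ≡ N) where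
  open Partial c N n c*j≡N

  clears⇒∣ : ∀ {d} → ClearsDenominators (G n) d → ∀ {k} → k < ⌊ n /2⌋ → N ∣ d * (2 * gapSum n (suc (2 * k)))
  clears⇒∣ {d} h {k} k<h = integral⇒∣ {A = gapSum n (suc (2 * k))} (innerSum-scaled c N n c*j≡N k (<⇒≤ (2+2k≤n k<h))) d k (clears⇒integral n d h k k<h)

  ∣⇒clears : ∀ {d} → 1 ≤ d → (∀ k → k < ⌊ n /2⌋ → N ∣ d * (2 * gapSum n (suc (2 * k)))) → ClearsDenominators (G n) d
  ∣⇒clears {d} 1≤d h = integral⇒clears n d 1≤d (λ k k<h →
    ∣⇒integral-cleared {A = gapSum n (suc (2 * k))} (innerSum-scaled c N n c*j≡N k (<⇒≤ (2+2k≤n k<h))) d k (h k k<h))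

  -- Clearing is a divisibility condition linear in the multiplier, so a nonzero remainder of `d`
  -- modulo `g` would also clear `G n`, against the minimality of `g`.
  isDenominator⇒∣ : ∀ {g d} → IsDenominator (G n) g → ClearsDenominators (G n) d → g ∣ d
  isDenominator⇒∣ {suc g} {d} (hg , least) h = go (d % suc g) refl
    where
    go : ∀ r → d % suc g ≡ r → suc g ∣ d
    go zero    eq = m%n≡0⇒n∣m d (suc g) eq
    go (suc r) eq = contradiction (least (suc r) (∣⇒clears (s≤s z≤n) remainder))
      (<⇒≱ (subst (_< suc g) eq (m%n<n d (suc g))))
      where
      remainder : ∀ k → k < ⌊ n /2⌋ → N ∣ suc r * (2 * gapSum n (suc (2 * k)))
      remainder k k<h = ∣m+n∣m⇒∣n
        (subst (N ∣_) (trans (cong (_* B) d≡) (*-distribʳ-+ B (d / suc g * suc g) (suc r))) (clears⇒∣ h k<h))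
        (subst (N ∣_) (sym (*-assoc (d / suc g) (suc g) B)) (∣n⇒∣m*n (d / suc g) (clears⇒∣ hg k<h)))
        where
        B = 2 * gapSum n (suc (2 * k))
        d≡ : d ≡ d / suc g * suc g + suc r
        d≡ = trans (m≡m%n+[m/n]*n d (suc g)) (trans (+-comm (d % suc g) _) (cong (λ z → d / suc g * suc g + z) eq))

-- 3-adic valuations

ν-unique : ∀ {e m} → 1 ≤ m → 3 ^ e ∣ m → ¬ 3 ^ suc e ∣ m → ν 3 m ≡ e
ν-unique {e} {m} 1≤m 3^e∣m 3^1+e∤m = ≤-antisym
  (≮⇒≥ (λ e<ν → 3^1+e∤m (∣-trans (m≤n⇒3^m∣3^n e<ν) (ν-∣ 3 m))))
  (ν-max 3 m (s≤s (s≤s z≤n)) 1≤m e 3^e∣m)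

3∤*3^⇒3^∤ : ∀ e {m} → ¬ 3 ∣ m → ¬ 3 ^ suc e ∣ 3 ^ e * m
3∤*3^⇒3^∤ e {m} 3∤m h = 3∤m (*-cancelˡ-∣ (3 ^ e) {{3^≢0 e}} (subst (_∣ 3 ^ e * m) (*-comm 3 (3 ^ e)) h))

decompose₃ : ∀ j → 1 ≤ j → ∃[ e ] ∃[ u ] j ≡ u * 3 ^ e × ¬ 3 ∣ u
decompose₃ j 1≤j with ν-∣ 3 j
... | divides u j≡ = ν 3 j , u , j≡ , λ 3∣u →
  <-irrefl refl (ν-max 3 j (s≤s (s≤s z≤n)) 1≤j (suc (ν 3 j))
    (subst (3 ^ suc (ν 3 j) ∣_) (sym j≡) (*-monoˡ-∣ (3 ^ ν 3 j) 3∣u)))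

bracket₃ : ∀ n → 1 ≤ n → ∃[ m ] 3 ^ m ≤ n × n < 3 ^ suc m
bracket₃ (suc zero)    _ = 0 , s≤s z≤n , s≤s (s≤s z≤n)
bracket₃ (suc (suc n)) _ with bracket₃ (suc n) (s≤s z≤n)
... | m , q≤n , n<3q with suc (suc n) <? 3 ^ suc m
... | yes 1+n<3q = m , m≤n⇒m≤1+n q≤n , 1+n<3q
... | no  1+n≮3q = suc m , ≮⇒≥ 1+n≮3q , (begin-strict
  suc (suc n)       ≤⟨ n<3q ⟩
  3 ^ suc m         <⟨ ^-monoʳ-< 3 (s≤s (s≤s z≤n)) (n<1+n (suc m)) ⟩
  3 ^ suc (suc m)   ∎)
  where open ≤-Reasoning

-- Each new index multiplies `K` by its part prime to 3 only; its power of 3 is at most `3 ^ M`,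
-- because the index is below `3 ^ suc M`.
commonMultiple₃ : ∀ M n → n < 3 ^ suc M → ∃[ K ] ¬ 3 ∣ K × (∀ j → 1 ≤ j → j ≤ n → j ∣ 3 ^ M * K)
commonMultiple₃ M zero    _ = 1 , 3∤1 , λ { j 1≤j j≤0 → contradiction (≤-trans 1≤j j≤0) (λ ()) }
commonMultiple₃ M (suc n) n<3q with commonMultiple₃ M n (<-trans (n<1+n n) n<3q) | decompose₃ (suc n) (s≤s z≤n)
... | K , 3∤K , ∣K | e , u , n≡ , 3∤u =
  K * u , [ 3∤K , 3∤u ]′ ∘ euclid₃ K u , λ j 1≤j j≤n → [ old j 1≤j , new ]′ (m≤n⇒m<n∨m≡n j≤n)
  where
  q = 3 ^ M
  old : ∀ j → 1 ≤ j → j < suc n → j ∣ q * (K * u)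
  old j 1≤j (s≤s j≤n) = subst (j ∣_) (*-assoc q K u) (∣m⇒∣m*n u (∣K j 1≤j j≤n))
  e≤M : e ≤ M
  e≤M = ≮⇒≥ λ M<e → <⇒≱ n<3q (∣⇒≤ (∣-trans (m≤n⇒3^m∣3^n M<e) (divides u n≡)))
  new : ∀ {j} → j ≡ suc n → j ∣ q * (K * u)
  new refl = subst₂ _∣_ (trans (*-comm (3 ^ e) u) (sym n≡)) (*-assoc q K u)
    (*-monoˡ-∣ u (∣m⇒∣m*n K (m≤n⇒3^m∣3^n e≤M)))

foldr-lcm-least : ∀ {x js} → All (_∣ x) js → foldr lcm 1 js ∣ x
foldr-lcm-least {x} []       = 1∣ x
foldr-lcm-least     (h ∷ hs) = lcm-least h (foldr-lcm-least hs)

∣foldr-lcm : ∀ f n {t} → t < n → f t ∣ foldr lcm 1 (applyUpTo f n)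
∣foldr-lcm f (suc n) {zero}  _         = m∣lcm[m,n] (f 0) _
∣foldr-lcm f (suc n) {suc t} (s≤s t<n) = ∣-trans (∣foldr-lcm (λ t → f (suc t)) n t<n) (n∣lcm[m,n] (f 0) _)

-- Parity serves twice: the sum of two powers of 3 is an admissible even index `s = 2k`, and a
-- single power of 3 is not.
3^-odd : ∀ m → ∃[ x ] 3 ^ m ≡ suc (2 * x)
3^-odd zero    = 0 , refl
3^-odd (suc m) with 3^-odd m
... | x , eq = suc (3 * x) , trans (cong (3 *_) eq) (regroup x)
  where
  regroup : ∀ x → 3 * suc (2 * x) ≡ suc (2 * suc (3 * x))
  regroup = solve-∀

2+2k≤n⇒k<⌊n/2⌋ : ∀ {n k} → suc (suc (2 * k)) ≤ n → k < ⌊ n /2⌋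
2+2k≤n⇒k<⌊n/2⌋ {n} {k} h = subst (λ z → suc z ≤ ⌊ n /2⌋)
  (trans (cong (λ z → ⌊ k + z /2⌋) (+-identityʳ k)) (sym (n≡⌊n+n/2⌋ k))) (⌊n/2⌋-mono h)

∣-≽ : ∀ {p x y} → x ≽ y [mod p ] → p ∣ y → p ∣ x
∣-≽ {p} (excess t refl) p∣y = ∣m∣n⇒∣m+n p∣y (m∣m*n t)

nonZero-divisor : ∀ {m n} .{{_ : NonZero n}} → m ∣ n → 1 ≤ m
nonZero-divisor {zero}  {n} 0∣n = contradiction (0∣⇒≡0 0∣n) (≢-nonZero⁻¹ n)
nonZero-divisor {suc m} _   = s≤s z≤n

3∤⇒nonZero : ∀ {m} → ¬ 3 ∣ m → NonZero m
3∤⇒nonZero {zero}  3∤0 = contradiction (3 ∣0) 3∤0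
3∤⇒nonZero {suc m} _   = _

-- The valuation of γ for n between consecutive powers of 3

module Bracketed (n M K : ℕ) (q≤n : 3 ^ M ≤ n) (n<3q : n < 3 ^ suc M) (3∤K : ¬ 3 ∣ K)
  (∣N : ∀ j → 1 ≤ j → j ≤ n → j ∣ 3 ^ M * K) where

  N : ℕ
  N = 3 ^ M * K

  instance
    N≢0 : NonZero N
    N≢0 = m*n≢0 (3 ^ M) K {{3^≢0 M}} {{3∤⇒nonZero 3∤K}}

  c : ℕ → ℕ
  -- A default value: the harmonic sums start at index 1.
  c zero    = 0
  c (suc j) = N / suc j

  c*j≡N : ∀ j → 1 ≤ j → j ≤ n → c j * j ≡ N
  c*j≡N (suc j) 1≤j j≤n = m/n*n≡m (∣N (suc j) 1≤j j≤n)

  open Partial c N n c*j≡N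
  open Clearing c N n c*j≡N

  A : ℕ → ℕ
  A k = gapSum n (suc (2 * k))

  A-closed : ∀ {k} → k < ⌊ n /2⌋ → A k + (n C (2 * k)) * ∑₁ c n ≡ (n C suc (2 * k)) * N + (n C (2 * k)) * ∑₁ c (2 * k)
  A-closed {k} k<h = gapSum-closed n (2 * k) ≤-refl (<⇒≤ (2+2k≤n k<h))

  -- The lcm divides `N`, whose part at 3 is exactly `3 ^ M`, and `3 ^ M` is itself among `1, …, n`.
  ν-lcm : ν 3 lcm[1… n ] ≡ M
  ν-lcm = ν-unique (nonZero-divisor lcm∣N) q∣lcm (λ h → 3∤*3^⇒3^∤ M 3∤K (∣-trans h lcm∣N))
    where
    lcm∣N : lcm[1… n ] ∣ N
    lcm∣N = foldr-lcm-least (All.applyUpTo⁺₁ (λ t → suc t) n (λ {t} t<n → ∣N (suc t) (s≤s z≤n) t<n))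
    q∣lcm : 3 ^ M ∣ lcm[1… n ]
    q∣lcm = ∣lcm (3 ^ M) (m^n>0 3 M) q≤n
      where
      ∣lcm : ∀ j → 1 ≤ j → j ≤ n → j ∣ lcm[1… n ]
      ∣lcm (suc t) _ t<n = ∣foldr-lcm suc n t<n

  γ∣ : ∀ D → 1 ≤ D → (∀ k → k < ⌊ n /2⌋ → N ∣ D * (2 * A k)) → γ n ∣ D
  γ∣ D 1≤D h = isDenominator⇒∣ (γ-isDenominator n) (∣⇒clears 1≤D h)

  N∣γ*2A : ∀ {k} → k < ⌊ n /2⌋ → N ∣ γ n * (2 * A k)
  N∣γ*2A = clears⇒∣ (proj₁ (γ-isDenominator n))

  1≤γ : 1 ≤ γ n
  1≤γ = proj₁ (proj₁ (γ-isDenominator n))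

  -- `N` clears `G n`, so `γ n` divides `N` and the upper bound always holds.
  ν-γ : 3 ^ M ∣ γ n → ν 3 (γ n) ≡ M
  ν-γ q∣γ = ν-unique 1≤γ q∣γ (λ h → 3∤*3^⇒3^∤ M 3∤K (∣-trans h (γ∣ N (nonZero-divisor ∣-refl) (λ k _ → m∣m*n (2 * A k)))))

  -- In `N ∣ γ n * (2 * A k)` the factor `2 * A k` is prime to 3, so all of `3 ^ M` must divide
  -- `γ n`.
  ν-γ-unit : ∀ {k} → k < ⌊ n /2⌋ → ¬ 3 ∣ A k → ν 3 (γ n) ≡ M
  ν-γ-unit {k} k<h 3∤A = ν-γ (3^∣*⇒3^∣ M ([ 3∤2 , 3∤A ]′ ∘ euclid₃ 2 (A k))
    (∣-trans (m∣m*n K) (subst (N ∣_) (*-comm (γ n) (2 * A k)) (N∣γ*2A k<h))))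

  c-divisible : ∀ e d → e + d ≡ M → ∀ j → 1 ≤ j → j ≤ n → ¬ 3 ^ e ∣ j → 3 ^ suc d ∣ c j
  c-divisible e d refl j 1≤j j≤n q∤j = [ (λ q∣j → contradiction q∣j q∤j) , id ]′
    (3^∣*-split e d j (c j) (subst (3 ^ M ∣_) (trans (sym (c*j≡N j 1≤j j≤n)) (*-comm (c j) j)) (m∣m*n K)))

  c-multiple : ∀ e d → e + d ≡ M → ∀ i → 1 ≤ i → i * 3 ^ e ≤ n → c (i * 3 ^ e) * i ≡ 3 ^ d * K
  c-multiple e d refl i 1≤i iq≤n = *-cancelʳ-≡ _ _ (3 ^ e) {{3^≢0 e}} (begin
    c (i * 3 ^ e) * i * 3 ^ e   ≡⟨ *-assoc (c (i * 3 ^ e)) i (3 ^ e) ⟩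
    c (i * 3 ^ e) * (i * 3 ^ e) ≡⟨ c*j≡N (i * 3 ^ e) (*-mono-≤ 1≤i (m^n>0 3 e)) iq≤n ⟩
    3 ^ (e + d) * K             ≡⟨ cong (_* K) (^-distribˡ-+-* 3 e d) ⟩
    3 ^ e * 3 ^ d * K           ≡⟨ regroup (3 ^ e) (3 ^ d) K ⟩
    3 ^ d * K * 3 ^ e           ∎)
    where
    open ≡-Reasoning
    regroup : ∀ x y z → x * y * z ≡ y * z * x
    regroup = solve-∀

  -- By `c-divisible` only multiples of `3 ^ e` count. The pair `(M , 0)` gives congruences modulo
  -- 3, the pair `(M - 1 , 1)` gives one modulo 9.
  ∑₁-c : ∀ e d → e + d ≡ M → ∀ b m → b < 3 ^ e → b + m * 3 ^ e ≤ n →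
    ∑₁ c (b + m * 3 ^ e) ≽ ∑₁ (λ i → c (i * 3 ^ e)) m [mod 3 ^ suc d ]
  ∑₁-c e d e+d≡M b m b<q x≤n = ∑₁-multiples c (3 ^ e) b m b<q
    (λ j 1≤j j≤x → c-divisible e d e+d≡M j 1≤j (≤-trans j≤x x≤n))

  3∣N : 1 ≤ M → 3 ∣ N
  3∣N 1≤M = ∣m⇒∣m*n K (m≤n⇒3^m∣3^n 1≤M)

  -- At `k = 0` the closed form reads `A 0 + ∑₁ c n = n N`. The right side is 0 modulo 3, while `q`
  -- is the only multiple of `q` up to `n`, so the harmonic sum is congruent to `c q = K`.
  unit-s=0 : ∀ {a} → 1 ≤ M → a < 3 ^ M → n ≡ a + 1 * 3 ^ M → ν 3 (γ n) ≡ M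
  unit-s=0 {a} 1≤M a<q n≡ = ν-γ-unit 0<h 3∤A
    where
    0<h : 0 < ⌊ n /2⌋
    0<h = 2+2k≤n⇒k<⌊n/2⌋ (≤-trans (s≤s (s≤s z≤n)) (≤-trans (^-monoʳ-≤ 3 1≤M) q≤n))
    1*q≤n : 1 * 3 ^ M ≤ n
    1*q≤n = subst (1 * 3 ^ M ≤_) (sym n≡) (m≤n+m (1 * 3 ^ M) a)
    ∑c : ∑₁ c n ≽ c (1 * 3 ^ M) [mod 3 ]
    ∑c = subst (λ z → ∑₁ c z ≽ c (1 * 3 ^ M) [mod 3 ]) (sym n≡)
      (∑₁-c M 0 (+-identityʳ M) a 1 a<q (≤-reflexive (sym n≡)))
    c≡K : c (1 * 3 ^ M) ≡ K
    c≡K = trans (sym (*-identityʳ _)) (trans (c-multiple M 0 (+-identityʳ M) 1 ≤-refl 1*q≤n) (*-identityˡ K))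
    3∤A : ¬ 3 ∣ A 0
    3∤A 3∣A = 3∤K (subst (3 ∣_) c≡K (≽-∣ ∑c (subst (3 ∣_) (trans (cong (_* ∑₁ c n) (nC0≡1 n)) (*-identityˡ _))
      (∣m+n∣m⇒∣n (subst (3 ∣_) (sym (A-closed 0<h))
        (∣m∣n⇒∣m+n (∣n⇒∣m*n (n C 1) (3∣N 1≤M)) (∣n⇒∣m*n (n C 0) (3 ∣0)))) 3∣A))))

  -- The index s = q + 3^t, where 3^t is the leading power of 3 in a = n - 2q:
  -- by Lucas C(n,s) ≡ 2 C(a,3^t), and q (Hₙ - Hₛ) ≡ 1/2 (mod 3).
  unit-s=q+Q : ∀ {a} → 1 ≤ M → 1 ≤ a → a < 3 ^ M → n ≡ a + 2 * 3 ^ M → ν 3 (γ n) ≡ M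
  unit-s=q+Q {a} 1≤M 1≤a a<q n≡ with bracket₃ a 1≤a
  ... | t , Q≤a , a<3Q with 3^-odd M | 3^-odd t
  ... | x , q≡ | y , Q≡ = ν-γ-unit k<h 3∤A
    where
    q = 3 ^ M
    Q = 3 ^ t
    -- From `q = 2x + 1` and `Q = 2y + 1`, so that `2k = Q + q`.
    k = suc (x + y)
    Q<q : Q < q
    Q<q = ≤-<-trans Q≤a a<q
    s≡ : 2 * k ≡ Q + q
    s≡ = trans (regroup x y) (sym (cong₂ _+_ Q≡ q≡))
      where
      regroup : ∀ x y → 2 * suc (x + y) ≡ suc (2 * y) + suc (2 * x)
      regroup = solve-∀
    s≡′ : 2 * k ≡ Q + 1 * q
    s≡′ = trans s≡ (cong (λ z → Q + z) (sym (*-identityˡ q)))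
    n≡′ : n ≡ q + (q + a)
    n≡′ = trans n≡ (regroup a q)
      where
      regroup : ∀ a q → a + 2 * q ≡ q + (q + a)
      regroup = solve-∀
    k<h : k < ⌊ n /2⌋
    k<h = 2+2k≤n⇒k<⌊n/2⌋ (subst₂ (λ u v → 2 + u ≤ v) (sym s≡) (sym n≡′)
      (subst (2 + (Q + q) ≤_) (regroup q a)
        (+-mono-≤ {2} {q} (≤-trans (s≤s (s≤s z≤n)) (^-monoʳ-≤ 3 1≤M)) (+-monoˡ-≤ q Q≤a))))
      where
      regroup : ∀ q a → q + (a + q) ≡ q + (q + a)
      regroup = solve-∀
    3∤C : ¬ 3 ∣ n C (2 * k)
    3∤C 3∣C = [ 3∤2 , 3∤nC3^t t a Q≤a a<3Q ]′ (euclid₃ 2 (a C Q) (subst (3 ∣_) twice (≽-∣ lucas 3∣C)))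
      where
      -- One `q` is split off `n = q + (q + a)`, then another off each resulting coefficient;
      -- `a C (Q + q)` vanishes because `a < q`.
      lucas : n C (2 * k) ≽ a C (Q + q) + a C Q + a C Q [mod 3 ]
      lucas = subst₂ (λ u v → u C v ≽ a C (Q + q) + a C Q + a C Q [mod 3 ]) (sym n≡′) (sym s≡)
        (≽-trans (lucas-high M (q + a) Q) (≽-+ (lucas-high M a Q) (lucas-low M a Q<q)))
      twice : a C (Q + q) + a C Q + a C Q ≡ 2 * (a C Q)
      twice = trans (cong (λ z → z + a C Q + a C Q) (k>n⇒nCk≡0 (<-≤-trans a<q (m≤n+m q Q))))
        (cong (λ z → a C Q + z) (sym (+-identityʳ (a C Q))))
    2*q≤n : 2 * q ≤ n
    2*q≤n = subst (2 * q ≤_) (sym n≡) (m≤n+m (2 * q) a)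
    3∤c : ¬ 3 ∣ c (2 * q)
    3∤c 3∣c = 3∤K (subst (3 ∣_) (trans (c-multiple M 0 (+-identityʳ M) 2 (s≤s z≤n) 2*q≤n) (*-identityˡ K)) (∣m⇒∣m*n 2 3∣c))
    ∑c[n] : ∑₁ c n ≽ c (1 * q) + c (2 * q) [mod 3 ]
    ∑c[n] = subst (λ z → ∑₁ c z ≽ c (1 * q) + c (2 * q) [mod 3 ]) (sym n≡)
      (∑₁-c M 0 (+-identityʳ M) a 2 a<q (≤-reflexive (sym n≡)))
    ∑c[s] : ∑₁ c (2 * k) ≽ c (1 * q) [mod 3 ]
    ∑c[s] = subst (λ z → ∑₁ c z ≽ c (1 * q) [mod 3 ]) (sym s≡′)
      (∑₁-c M 0 (+-identityʳ M) Q 1 Q<q (subst (_≤ n) s≡′ (≤-trans (n≤1+n _) (<⇒≤ (2+2k≤n k<h)))))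
    3∤A : ¬ 3 ∣ A k
    3∤A 3∣A with ∑₁ c n | ∑₁ c (2 * k) | ∑c[n] | ∑c[s] | A-closed k<h
    ... | _ | _ | excess u refl | excess v refl | closed = [ 3∤C , 3∤c ]′ (euclid₃ (n C (2 * k)) (c (2 * q))
      (∣m+n∣m⇒∣n (subst (3 ∣_) (sym cancelled) (∣m∣n⇒∣m+n (∣n⇒∣m*n (n C suc (2 * k)) (3∣N 1≤M)) (m∣m*n ((n C (2 * k)) * v))))
        (∣m∣n⇒∣m+n 3∣A (m∣m*n ((n C (2 * k)) * u)))))
      where
      -- The term `c (1 * q)` occurs in both harmonic sums and cancels; what remains modulo 3 is
      -- `C(n,s) c (2 * q)`, a product of units.
      cancelled : A k + 3 * ((n C (2 * k)) * u) + (n C (2 * k)) * c (2 * q) ≡ (n C suc (2 * k)) * N + 3 * ((n C (2 * k)) * v)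
      cancelled = +-cancelʳ-≡ ((n C (2 * k)) * c (1 * q)) _ _
        (trans (left (A k) (n C (2 * k)) u (c (1 * q)) (c (2 * q)))
        (trans closed (right ((n C suc (2 * k)) * N) (n C (2 * k)) v (c (1 * q)))))
        where
        left : ∀ a b u x y → a + 3 * (b * u) + b * y + b * x ≡ a + b * (x + y + 3 * u)
        left = solve-∀
        right : ∀ a b v x → a + b * (x + 3 * v) ≡ a + 3 * (b * v) + b * x
        right = solve-∀

  -- The exceptional case of twice a power of 3

  module Exceptional (M′ : ℕ) (M≡ : M ≡ suc M′) (n≡ : n ≡ 2 * 3 ^ M) where

    private
      q = 3 ^ M
      q′ = 3 ^ M′

    q≡ : q ≡ 3 * q′
    q≡ = cong (3 ^_) M≡

    -- Modulo 3 only `c q` and `c (2 * q)` remain, and `c q = 2 c (2 * q)`, so they add up to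
    -- `3 c (2 * q)`.
    3∣x*∑c[n] : ∀ x → 3 ∣ x * ∑₁ c n
    3∣x*∑c[n] x = ∣n⇒∣m*n x (∣-≽ ∑c (divides (c (2 * q)) K+y))
      where
      ∑c : ∑₁ c n ≽ c (1 * q) + c (2 * q) [mod 3 ]
      ∑c = subst (λ z → ∑₁ c z ≽ c (1 * q) + c (2 * q) [mod 3 ]) (sym n≡)
        (∑₁-c M 0 (+-identityʳ M) 0 2 (m^n>0 3 M) (≤-reflexive (sym n≡)))
      K+y : c (1 * q) + c (2 * q) ≡ c (2 * q) * 3
      K+y = begin
        c (1 * q) + c (2 * q)         ≡⟨ cong (_+ c (2 * q)) (*-identityʳ (c (1 * q))) ⟨
        c (1 * q) * 1 + c (2 * q)     ≡⟨ cong (_+ c (2 * q)) (c-multiple M 0 (+-identityʳ M) 1 ≤-refl (≤-trans (≤-reflexive (*-identityˡ q)) q≤n)) ⟩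
        1 * K + c (2 * q)             ≡⟨ cong (_+ c (2 * q)) (c-multiple M 0 (+-identityʳ M) 2 (s≤s z≤n) (≤-reflexive (sym n≡))) ⟨
        c (2 * q) * 2 + c (2 * q)     ≡⟨ regroup (c (2 * q)) ⟩
        c (2 * q) * 3                 ∎
        where
        open ≡-Reasoning
        regroup : ∀ x → x * 2 + x ≡ x * 3
        regroup = solve-∀

    -- For `s < q` no multiple of `q` enters the harmonic sum. For `s ≥ q` the binomial coefficient
    -- is divisible by 3, as `q` divides `n` but not `s`.
    3∣C*∑c[s] : ∀ k → k < ⌊ n /2⌋ → 3 ∣ (n C (2 * k)) * ∑₁ c (2 * k)
    3∣C*∑c[s] k k<h with 2 * k <? q
    ... | yes s<q = ∣n⇒∣m*n (n C (2 * k)) (∣-≽ ∑c (3 ∣0))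
      where
      ∑c : ∑₁ c (2 * k) ≽ 0 [mod 3 ]
      ∑c = subst (λ z → ∑₁ c z ≽ 0 [mod 3 ]) (+-identityʳ (2 * k))
        (∑₁-c M 0 (+-identityʳ M) (2 * k) 0 s<q
          (≤-trans (≤-reflexive (+-identityʳ (2 * k))) (≤-trans (<⇒≤ s<q) q≤n)))
    ... | no s≮q = ∣m⇒∣m*n (∑₁ c (2 * k)) (3^∣n∧3^∤k⇒3∣nCk M n (2 * k) (subst (q ∣_) (sym n≡) (n∣m*n 2)) q∤s)
      where
      -- Since `s < n = 2q`, the multiple could only be 0, excluded by `s ≥ q`, or `q`, excluded by
      -- parity.
      q∤s : ¬ q ∣ 2 * k
      q∤s (divides 0 s≡) = s≮q (subst (_< q) (sym s≡) (m^n>0 3 M))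
      q∤s (divides 1 s≡) with 3^-odd M
      ... | x , q≡1+2x = even≢odd k x (trans s≡ (trans (*-identityˡ q) q≡1+2x))
      q∤s (divides (suc (suc w)) s≡) = <⇒≱ (<-trans (n<1+n _) (2+2k≤n k<h))
        (subst₂ _≤_ (sym n≡) (sym s≡) (*-monoˡ-≤ q (s≤s (s≤s (z≤n {w})))))

    3∣A : ∀ k → k < ⌊ n /2⌋ → 3 ∣ A k
    3∣A k k<h = ∣m+n∣m⇒∣n
      (subst (3 ∣_) (trans (sym (A-closed k<h)) (+-comm (A k) _))
        (∣m∣n⇒∣m+n (∣n⇒∣m*n (n C suc (2 * k)) (3∣N (subst (1 ≤_) (sym M≡) (s≤s z≤n)))) (3∣C*∑c[s] k k<h)))
      (3∣x*∑c[n] (n C (2 * k)))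

    -- Up to multiples of 3, (q/3) Hₙ is 1 + 1/2 + ⋯ + 1/6 = 49/20, a unit; S is 3K times this sum.
    9∤∑c[n] : ¬ 9 ∣ ∑₁ c n
    9∤∑c[n] 9∣∑ = 3∤49K (divides (20 * quotient 9∣S) (*-cancelʳ-≡ _ _ 9 (begin
      49 * K * 9                         ≡⟨ scaled ⟨
      60 * S                             ≡⟨ cong (60 *_) (_∣_.equality 9∣S) ⟩
      60 * (quotient 9∣S * 9)            ≡⟨ regroup (quotient 9∣S) ⟩
      20 * quotient 9∣S * 3 * 9          ∎)))
      where
      open ≡-Reasoning
      b : ℕ → ℕ
      b i = c (i * q′)
      S = ∑₁ b 6
      6*q′≡n : 6 * q′ ≡ n
      6*q′≡n = sym (trans n≡ (trans (cong (2 *_) q≡) (sym (*-assoc 2 3 q′))))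
      9∣S : 9 ∣ S
      9∣S = ≽-∣ (subst (λ z → ∑₁ c z ≽ S [mod 9 ]) 6*q′≡n
        (∑₁-c M′ 1 (trans (+-comm M′ 1) (sym M≡)) 0 6 (m^n>0 3 M′) (≤-reflexive 6*q′≡n))) 9∣∑
      b≡ : ∀ i → 1 ≤ i → i ≤ 6 → b i * i ≡ 3 * K
      b≡ i 1≤i i≤6 = c-multiple M′ 1 (trans (+-comm M′ 1) (sym M≡)) i 1≤i
        (≤-trans (*-monoˡ-≤ q′ i≤6) (≤-reflexive 6*q′≡n))
      3∤49K : ¬ 3 ∣ 49 * K
      3∤49K = [ from-no (3 ∣? 49) , 3∤K ]′ ∘ euclid₃ 49 K
      regroup : ∀ w → 60 * (w * 9) ≡ 20 * w * 3 * 9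
      regroup = solve-∀
      scaled : 60 * S ≡ 49 * K * 9
      scaled = begin
        60 * S
          -- The weights are `60 / i` with `60 = lcm(1, …, 6)`; they sum to `147 = 3 * 49`, and each
          -- `b i * i` equals `3 * K`.
          ≡⟨ weigh (b 1) (b 2) (b 3) (b 4) (b 5) (b 6) ⟩
        60 * (b 1 * 1) + 30 * (b 2 * 2) + 20 * (b 3 * 3) + 15 * (b 4 * 4) + 12 * (b 5 * 5) + 10 * (b 6 * 6)
          ≡⟨ cong₂ _+_ (cong₂ _+_ (cong₂ _+_ (cong₂ _+_ (cong₂ _+_
               (cong (60 *_) (b≡ 1 (s≤s z≤n) (s≤s z≤n)))
               (cong (30 *_) (b≡ 2 (s≤s z≤n) (m≤m+n 2 4))))
               (cong (20 *_) (b≡ 3 (s≤s z≤n) (m≤m+n 3 3))))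
               (cong (15 *_) (b≡ 4 (s≤s z≤n) (m≤m+n 4 2))))
               (cong (12 *_) (b≡ 5 (s≤s z≤n) (m≤m+n 5 1))))
               (cong (10 *_) (b≡ 6 (s≤s z≤n) ≤-refl)) ⟩
        60 * (3 * K) + 30 * (3 * K) + 20 * (3 * K) + 15 * (3 * K) + 12 * (3 * K) + 10 * (3 * K)
          ≡⟨ collect K ⟩
        49 * K * 9 ∎
        where
        weigh : ∀ b₁ b₂ b₃ b₄ b₅ b₆ → 60 * (0 + b₁ + b₂ + b₃ + b₄ + b₅ + b₆) ≡
          60 * (b₁ * 1) + 30 * (b₂ * 2) + 20 * (b₃ * 3) + 15 * (b₄ * 4) + 12 * (b₅ * 5) + 10 * (b₆ * 6)
        weigh = solve-∀
        collect : ∀ K → 60 * (3 * K) + 30 * (3 * K) + 20 * (3 * K) + 15 * (3 * K) + 12 * (3 * K) + 10 * (3 * K) ≡ 49 * K * 9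
        collect = solve-∀

    N≡3*q′K : N ≡ 3 * (q′ * K)
    N≡3*q′K = trans (cong (_* K) q≡) (*-assoc 3 q′ K)

    0<h : 0 < ⌊ n /2⌋
    0<h = 2+2k≤n⇒k<⌊n/2⌋ (≤-trans (≤-reflexive (sym (*-identityʳ 2)))
      (subst (2 * 1 ≤_) (sym n≡) (*-monoʳ-≤ 2 (m^n>0 3 M))))

    -- In `A 0 + ∑₁ c n = n N` both `n` and `N` are divisible by 3, so modulo 9 the right side
    -- vanishes and `9∤∑c[n]` decides.
    9∤A : ¬ 9 ∣ A 0
    9∤A 9∣A = 9∤∑c[n] (subst (9 ∣_) (trans (cong (_* ∑₁ c n) (nC0≡1 n)) (*-identityˡ _))
      (∣m+n∣m⇒∣n (subst (9 ∣_) (sym (A-closed 0<h)) (∣m∣n⇒∣m+n 9∣C*N (∣n⇒∣m*n (n C 0) (9 ∣0)))) 9∣A))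
      where
      9∣C*N : 9 ∣ (n C 1) * N
      9∣C*N = *-pres-∣ {o = 3} {p = 3}
        (subst (3 ∣_) (sym (nC1≡n n)) (subst (3 ∣_) (sym (trans n≡ (cong (2 *_) q≡))) (∣n⇒∣m*n 2 (m∣m*n q′))))
        (subst (3 ∣_) (sym N≡3*q′K) (m∣m*n (q′ * K)))

    -- Since 3 divides every `A k`, already `N / 3 = q′ * K` clears `G n`. Conversely `2 * A 0`
    -- absorbs at most one factor 3 of `N`, which leaves `3 ^ M′` for `γ n`.
    ν-γ-exceptional : ν 3 (γ n) ≡ M′
    ν-γ-exceptional = ν-unique 1≤γ lower (λ h → 3∤*3^⇒3^∤ M′ 3∤K (∣-trans h upper))
      where
      upper : γ n ∣ q′ * K
      upper = γ∣ (q′ * K) (>-nonZero⁻¹ (q′ * K) {{m*n≢0 q′ K {{3^≢0 M′}} {{3∤⇒nonZero 3∤K}}}}) (λ k k<h →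
        subst (_∣ q′ * K * (2 * A k)) (trans (*-comm (q′ * K) 3) (sym N≡3*q′K))
          (*-monoʳ-∣ (q′ * K) (∣n⇒∣m*n 2 (3∣A k k<h))))
      lower : q′ ∣ γ n
      lower = [ id , (λ 9∣2A → contradiction (3^∣*⇒3^∣ 2 3∤2 9∣2A) 9∤A) ]′
        (3^∣*-split M′ 1 (γ n) (2 * A 0) (subst (λ z → 3 ^ z ∣ γ n * (2 * A 0)) (trans M≡ (+-comm 1 M′))
          (∣-trans (m∣m*n K) (N∣γ*2A 0<h))))

-- Assembling the cases

theorem5p9 : ∀ (n : ℕ) → 1 ≤ n →
    ((∃[ m ] 1 ≤ m × n ≡ 2 * 3 ^ m) →
    + ν 3 (γ n) ≡ + ν 3 lcm[1… n ] - + 1)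
    × (¬ (∃[ m ] 1 ≤ m × n ≡ 2 * 3 ^ m) →
    ν 3 (γ n) ≡ ν 3 lcm[1… n ])
theorem5p9 n 1≤n = exceptional , generic
  where
  exceptional : (∃[ m ] 1 ≤ m × n ≡ 2 * 3 ^ m) → + ν 3 (γ n) ≡ + ν 3 lcm[1… n ] - + 1
  exceptional (M@(suc M′) , _ , n≡) =
    -- With `M = suc M′` the integer `+ M - + 1` computes to `+ M′`.
    trans (cong (λ z → + z) ν-γ-exceptional) (cong (λ z → + z - + 1) (sym ν-lcm))
    where
    q≤n : 3 ^ M ≤ n
    q≤n = subst (3 ^ M ≤_) (sym n≡) (m≤m+n (3 ^ M) (1 * 3 ^ M))
    n<3q : n < 3 ^ suc M
    n<3q = subst (_< 3 ^ suc M) (sym n≡) (*-monoˡ-< (3 ^ M) {{3^≢0 M}} {2} {3} ≤-refl)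
    common = commonMultiple₃ M n n<3q
    open Bracketed n M (proj₁ common) q≤n n<3q (proj₁ (proj₂ common)) (proj₂ (proj₂ common))
    open Exceptional M′ refl n≡
  generic : ¬ (∃[ m ] 1 ≤ m × n ≡ 2 * 3 ^ m) → ν 3 (γ n) ≡ ν 3 lcm[1… n ]
  generic ¬exceptional with bracket₃ n 1≤n
  ... | M , q≤n , n<3q = trans (ν-γ≡M (1 ≤? M) (a <? 3 ^ M)) (sym ν-lcm)
    where
    common = commonMultiple₃ M n n<3q
    open Bracketed n M (proj₁ common) q≤n n<3q (proj₁ (proj₂ common)) (proj₂ (proj₂ common))
    a = n ∸ 3 ^ M
    n≡a+q : n ≡ a + 3 ^ M
    n≡a+q = sym (m∸n+n≡m q≤n)
    ν-γ≡M : Dec (1 ≤ M) → Dec (a < 3 ^ M) → ν 3 (γ n) ≡ M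
    -- Here `M = 0`, that is `n < 3`, and `3 ^ 0` divides everything; `n = 2` falls under this case.
    ν-γ≡M (no 1≰M) _ = ν-γ (subst (λ m → 3 ^ m ∣ γ n) (sym (n<1⇒n≡0 (≰⇒> 1≰M))) (1∣ γ n))
    ν-γ≡M (yes 1≤M) (yes a<q) = unit-s=0 1≤M a<q (trans n≡a+q (cong (λ z → a + z) (sym (*-identityˡ (3 ^ M)))))
    ν-γ≡M (yes 1≤M) (no a≮q) = unit-s=q+Q 1≤M 1≤a′ a′<q n≡a′+2q
      where
      a′ = a ∸ 3 ^ M
      n≡a′+2q : n ≡ a′ + 2 * 3 ^ M
      n≡a′+2q = trans n≡a+q (trans (cong (_+ 3 ^ M) (sym (m∸n+n≡m (≮⇒≥ a≮q)))) (regroup a′ (3 ^ M)))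
        where
        regroup : ∀ x q → x + q + q ≡ x + 2 * q
        regroup = solve-∀
      -- `a′ = 0` would make `n` twice the power `3 ^ M` with `M ≥ 1`, the excluded form.
      1≤a′ : 1 ≤ a′
      1≤a′ = n≢0⇒n>0 (λ a′≡0 → ¬exceptional (M , 1≤M , trans n≡a′+2q (cong (_+ 2 * 3 ^ M) a′≡0)))
      a′<q : a′ < 3 ^ M
      a′<q = +-cancelʳ-< (2 * 3 ^ M) a′ (3 ^ M) (subst (_< 3 ^ suc M) n≡a′+2q n<3q)
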